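{- Assume that all maps of the form $\mathit{acc}[K]\otimes\mathit{acc}[L]$ are coequalisers too (namely, of the maps $\underline{\sigma}\otimes\underline{\tau}$ for $\sigma\in S_K$, $\tau\in S_L$), for instance because $\otimes$ preserves coequalisers. Then: \begin{enumerate} \item The sum of multisets $+\colon \mathcal{M}[K](X)\otimes\mathcal{M}[L](X)\to\mathcal{M}[K+L](X)$ satisfies $+\circ(\mathit{acc}[K]\otimes\mathit{acc}[L]) = \mathit{acc}[K+L]\circ \mathbin{+\!\!+}$, where $\mathbin{+\!\!+}\colon X^K\otimes X^L\cong X^{K+L}$ is concatenation, and is thus a (mediating) deterministic map. \item The maps $\sum_K\colon \mathcal{M}[L](X)^K\to\mathcal{M}[K\cdot L](X)$ and $\mu_{K,L}\colon\mathcal{M}[K](\mathcal{M}[L](X))\to\mathcal{M}[K\cdot L](X)$ are natural in $X$. \item The maps $\mu_{K,L}$, together with the maps $\mathit{acc}[1]\colon X\to\mathcal{M}[1](X)$ as unit, turn the functors $\mathcal{M}[K]$ into a graded monad on $\mathbf{C}$ with respect to the multiplicative monoid $(\mathbb{N},\cdot,1)$ of natural numbers. \end{enumerate}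
   Context: Setting. $\mathbf{C}$ is a fixed Markov category: a symmetric monoidal category $(\mathbf{C},\otimes,1)$ whose tensor unit $1$ is a final object (so there are projections $\pi_1\colon X\otimes Y\to X\otimes 1\cong X$, etc.; $!$ denotes maps to $1$), in which every object $X$ carries a commutative, associative, counital (with counit $!$) comonoid structure $\delta\colon X\to X\otimes X$ (copying), compatible with the monoidal structure. A map $f$ is deterministic if $(f\otimes f)\circ\delta=\delta\circ f$; arbitrary maps need not be deterministic, but all monoidal isomorphisms are. $\mathbf{C}$ has finite colimits; the coprojections into colimits are deterministic, and the mediating map induced by deterministic maps is deterministic; $\otimes$ distributes over finite coproducts $+$ (with initial object $0$). Write $X^K=X\otimes\cdots\otimes X$ ($K$ times, $X^0=1$) and $f^K=f\otimes\cdots\otimes f$. Monoidal coherence isomorphisms are suppressed. Uniform states. Let $\underline{n}=1+\cdots+1$ ($n$ times). For each $n\ge1$ there is a given map $u_n\colon 1\to\underline{n}$ such that $\sigma\circ u_n=u_n$ for each permutation $\sigma\colon\underline{n}\cong\underline{n}$, and $u_n\otimes u_m=u_{n\cdot m}$ up to the isomorphism $\underline{n}\otimes\underline{m}\cong\underline{n\cdot m}$. For $r\colon1\to\underline{n}$ and maps $f_1,\dots,f_n\colon X\to Y$ the convex sum $\sum_i r\cdot f_i$ is the composite $X\cong X\otimes1\xrightarrow{\mathrm{id}\otimes r}X\otimes\underline{n}\cong X+\cdots+X\xrightarrow{[f_1,\dots,f_n]}Y$. Multisets. For $\sigma\in S_K$ (permutations of $\{1,\dots,K\}$) let $\underline{\sigma}\colon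 X^K\cong X^K$ be the induced permutation of tensor factors. The map $\mathit{acc}[K]\colon X^K\to\mathcal{M}[K](X)$ is the coequaliser of all the maps $\underline{\sigma}$, $\sigma\in S_K$. $\mathcal{M}[K]$ is a functor: for $f\colon X\to Y$, $\mathcal{M}[K](f)$ is the unique map with $\mathcal{M}[K](f)\circ\mathit{acc}[K]=\mathit{acc}[K]\circ f^K$. Let $\mathit{perm}=\sum_{\sigma\in S_K}u_{K!}\cdot\underline{\sigma}\colon X^K\to X^K$; the arrangement map $\mathit{arr}[K]\colon\mathcal{M}[K](X)\to X^K$ is the unique map with $\mathit{arr}[K]\circ\mathit{acc}[K]=\mathit{perm}$. (The argument $[K]$ is often omitted.) Sums. The sum of multisets is $+ := \mathit{acc}[K+L]\circ\mathbin{+\!\!+}\circ(\mathit{arr}[K]\otimes\mathit{arr}[L])\colon\mathcal{M}[K](X)\otimes\mathcal{M}[L](X)\to\mathcal{M}[K+L](X)$; it is associative and commutative. Using this, $\sum_K\colon\mathcal{M}[L](X)^K\to\mathcal{M}[K\cdot L](X)$ is the $K$-fold sum for $K\geq 1$ (with $\sum_1=\mathrm{id}$), and $\sum_0:=\mathit{acc}[0]\colon 1\to\mathcal{M}[0](X)$. The map $\mu_{K,L}\colon\mathcal{M}[K](\mathcal{M}[L](X))\to\mathcal{M}[K\cdot L](X)$ is the unique map with $\mu_{K,L}\circ\mathit{acc}[K]=\sum_K$. A graded monad over $(\mathbb{N},\cdot,1)$ consists of functors $T_K$ ($K\in\mathbb{N}$), a natural unit $\eta\colon\mathrm{id}\Rightarrow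 T_1$ and natural multiplications $\mu_{K,L}\colon T_KT_L\Rightarrow T_{K\cdot L}$ with $\mu_{1,K}\circ\eta_{T_K}=\mathrm{id}$, $\mu_{K,1}\circ T_K(\eta)=\mathrm{id}$ and $\mu_{K\cdot L,N}\circ(\mu_{K,L})_{T_N}=\mu_{K,L\cdot N}\circ T_K(\mu_{L,N})$. -}

module Defs where

open import Level using (_⊔_) renaming (suc to lsuc)
open import Data.Empty using (⊥-elim)
open import Data.Fin using (Fin; zero; suc; combine; remQuot; punchIn)
open import Data.Fin.Permutation as Perm
  using (Permutation′; _⟨$⟩ʳ_; insert; remove; insert-remove; remove-insert; insert-punchIn)
open import Data.Fin.Properties
  using (¬Fin0; punchIn-injective; remQuot-combine; combine-remQuot)
open import Data.Nat using (ℕ; zero; suc; _+_; _*_; _!; NonZero)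
open import Data.Nat.Properties using (m*n≢0; _!≢0; *-identityˡ; *-identityʳ; *-assoc)
open import Data.Product using (∃-syntax; _×_; _,_; proj₁; proj₂)
open import Relation.Binary.Structures using (IsEquivalence)
open import Relation.Binary.PropositionalEquality as ≡ using (_≡_; refl; cong; subst)

record Category o ℓ e : Set (lsuc (o ⊔ ℓ ⊔ e)) where
  infix  4 _⇒_ _≈_
  infixr 9 _∘_
  field
    Obj : Set o
    _⇒_ : Obj → Obj → Set ℓ
    _≈_ : ∀ {A B} → A ⇒ B → A ⇒ B → Set e
    id  : ∀ {A} → A ⇒ A
    _∘_ : ∀ {A B C} → B ⇒ C → A ⇒ B → A ⇒ C

    ≈-equiv   : ∀ {A B} → IsEquivalence (_≈_ {A} {B})
    ∘-resp-≈  : ∀ {A B C} {f f′ : B ⇒ C} {g g′ : A ⇒ B} →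
                f ≈ f′ → g ≈ g′ → f ∘ g ≈ f′ ∘ g′
    identityˡ : ∀ {A B} {f : A ⇒ B} → id ∘ f ≈ f
    identityʳ : ∀ {A B} {f : A ⇒ B} → f ∘ id ≈ f
    assoc     : ∀ {A B C D} {f : A ⇒ B} {g : B ⇒ C} {h : C ⇒ D} →
                (h ∘ g) ∘ f ≈ h ∘ (g ∘ f)

  module ≈ {A B} = IsEquivalence (≈-equiv {A} {B})

  record IsIso {A B} (f : A ⇒ B) : Set (ℓ ⊔ e) where
    field
      inv  : B ⇒ A
      isoˡ : inv ∘ f ≈ id
      isoʳ : f ∘ inv ≈ id

  record IsCoequaliser {I : Set} {A B Q} (f : I → A ⇒ B) (q : B ⇒ Q) : Set (o ⊔ ℓ ⊔ e) where
    field
      equalises : ∀ i j → q ∘ f i ≈ q ∘ f j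
      mediate   : ∀ {Z} (h : B ⇒ Z) → (∀ i j → h ∘ f i ≈ h ∘ f j) → Q ⇒ Z
      mediate-∘ : ∀ {Z} (h : B ⇒ Z) (eq : ∀ i j → h ∘ f i ≈ h ∘ f j) → mediate h eq ∘ q ≈ h
      unique    : ∀ {Z} {h k : Q ⇒ Z} → h ∘ q ≈ k ∘ q → h ≈ k

record SymmetricMonoidal {o ℓ e} (C : Category o ℓ e) : Set (o ⊔ ℓ ⊔ e) where
  open Category C
  infixr 10 _⊗₀_ _⊗₁_
  field
    _⊗₀_ : Obj → Obj → Obj
    _⊗₁_ : ∀ {A B A′ B′} → A ⇒ A′ → B ⇒ B′ → A ⊗₀ B ⇒ A′ ⊗₀ B′
    unit : Obj

    ⊗-resp-≈ : ∀ {A B A′ B′} {f f′ : A ⇒ A′} {g g′ : B ⇒ B′} →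
               f ≈ f′ → g ≈ g′ → f ⊗₁ g ≈ f′ ⊗₁ g′
    ⊗-id     : ∀ {A B} → id {A} ⊗₁ id {B} ≈ id
    ⊗-∘      : ∀ {A B A′ B′ A″ B″} {f : A ⇒ A′} {f′ : A′ ⇒ A″} {g : B ⇒ B′} {g′ : B′ ⇒ B″} →
               (f′ ∘ f) ⊗₁ (g′ ∘ g) ≈ (f′ ⊗₁ g′) ∘ (f ⊗₁ g)

    unitˡ⇒  : ∀ {A} → unit ⊗₀ A ⇒ A
    unitˡ⇐  : ∀ {A} → A ⇒ unit ⊗₀ A
    unitʳ⇒  : ∀ {A} → A ⊗₀ unit ⇒ A
    unitʳ⇐  : ∀ {A} → A ⇒ A ⊗₀ unit
    assoc⇒  : ∀ {A B C} → (A ⊗₀ B) ⊗₀ C ⇒ A ⊗₀ (B ⊗₀ C)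
    assoc⇐  : ∀ {A B C} → A ⊗₀ (B ⊗₀ C) ⇒ (A ⊗₀ B) ⊗₀ C
    braid   : ∀ {A B} → A ⊗₀ B ⇒ B ⊗₀ A

    unitˡ-isoˡ : ∀ {A} → unitˡ⇐ ∘ unitˡ⇒ {A} ≈ id
    unitˡ-isoʳ : ∀ {A} → unitˡ⇒ ∘ unitˡ⇐ {A} ≈ id
    unitʳ-isoˡ : ∀ {A} → unitʳ⇐ ∘ unitʳ⇒ {A} ≈ id
    unitʳ-isoʳ : ∀ {A} → unitʳ⇒ ∘ unitʳ⇐ {A} ≈ id
    assoc-isoˡ : ∀ {A B C} → assoc⇐ ∘ assoc⇒ {A} {B} {C} ≈ id
    assoc-isoʳ : ∀ {A B C} → assoc⇒ ∘ assoc⇐ {A} {B} {C} ≈ id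
    braid-iso  : ∀ {A B} → braid ∘ braid {A} {B} ≈ id

    unitˡ-natural : ∀ {A B} {f : A ⇒ B} → unitˡ⇒ ∘ (id ⊗₁ f) ≈ f ∘ unitˡ⇒
    unitʳ-natural : ∀ {A B} {f : A ⇒ B} → unitʳ⇒ ∘ (f ⊗₁ id) ≈ f ∘ unitʳ⇒
    assoc-natural : ∀ {A B C A′ B′ C′} {f : A ⇒ A′} {g : B ⇒ B′} {h : C ⇒ C′} →
                    assoc⇒ ∘ ((f ⊗₁ g) ⊗₁ h) ≈ (f ⊗₁ (g ⊗₁ h)) ∘ assoc⇒
    braid-natural : ∀ {A B A′ B′} {f : A ⇒ A′} {g : B ⇒ B′} →
                    braid ∘ (f ⊗₁ g) ≈ (g ⊗₁ f) ∘ braid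

    triangle : ∀ {A B} → (id {A} ⊗₁ unitˡ⇒ {B}) ∘ assoc⇒ ≈ unitʳ⇒ ⊗₁ id
    pentagon : ∀ {A B C D} →
               (id {A} ⊗₁ assoc⇒ {B} {C} {D}) ∘ assoc⇒ ∘ (assoc⇒ ⊗₁ id) ≈ assoc⇒ ∘ assoc⇒
    hexagon  : ∀ {A B C} →
               (id {B} ⊗₁ braid {A} {C}) ∘ assoc⇒ ∘ (braid ⊗₁ id) ≈ assoc⇒ ∘ braid ∘ assoc⇒

  exchange : ∀ {A B C} → A ⊗₀ (B ⊗₀ C) ⇒ B ⊗₀ (A ⊗₀ C)
  exchange = assoc⇒ ∘ (braid ⊗₁ id) ∘ assoc⇐

  interchange : ∀ {A B C D} → (A ⊗₀ B) ⊗₀ (C ⊗₀ D) ⇒ (A ⊗₀ C) ⊗₀ (B ⊗₀ D)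
  interchange = assoc⇐ ∘ (id ⊗₁ exchange) ∘ assoc⇒

record Markov {o ℓ e} {C : Category o ℓ e} (S : SymmetricMonoidal C) : Set (o ⊔ ℓ ⊔ e) where
  open Category C
  open SymmetricMonoidal S
  field
    discard        : ∀ {A} → A ⇒ unit
    discard-unique : ∀ {A} {f g : A ⇒ unit} → f ≈ g

    δ          : ∀ {A} → A ⇒ A ⊗₀ A
    δ-assoc    : ∀ {A} → assoc⇒ ∘ (δ ⊗₁ id) ∘ δ {A} ≈ (id ⊗₁ δ) ∘ δ
    δ-comm     : ∀ {A} → braid ∘ δ {A} ≈ δ
    δ-counitˡ  : ∀ {A} → unitˡ⇒ ∘ (discard ⊗₁ id) ∘ δ {A} ≈ id
    δ-counitʳ  : ∀ {A} → unitʳ⇒ ∘ (id ⊗₁ discard) ∘ δ {A} ≈ id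
    δ-⊗        : ∀ {A B} → δ {A ⊗₀ B} ≈ interchange ∘ (δ ⊗₁ δ)
    δ-unit     : δ {unit} ≈ unitˡ⇐

  Deterministic : ∀ {A B} → A ⇒ B → Set e
  Deterministic f = (f ⊗₁ f) ∘ δ ≈ δ ∘ f

  -- The inverses are then deterministic as well.
  field
    unitˡ-det : ∀ {A} → Deterministic (unitˡ⇒ {A})
    unitʳ-det : ∀ {A} → Deterministic (unitʳ⇒ {A})
    assoc-det : ∀ {A B C} → Deterministic (assoc⇒ {A} {B} {C})
    braid-det : ∀ {A B} → Deterministic (braid {A} {B})

module _ {o ℓ e} (C : Category o ℓ e) where
  open Category C

  -- Shapes are finite graphs; replacing each edge by a span from its midpoint
  -- turns these into finite categories without changing colimits.
  record FiniteDiagram : Set (o ⊔ ℓ) where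
    field
      {vertices edges} : ℕ
      {source target}  : Fin edges → Fin vertices
      obj   : Fin vertices → Obj
      arrow : ∀ i → obj (source i) ⇒ obj (target i)

  module _ (D : FiniteDiagram) where
    open FiniteDiagram D

    record Cocone : Set (o ⊔ ℓ ⊔ e) where
      field
        {apex}  : Obj
        leg     : ∀ v → obj v ⇒ apex
        commute : ∀ i → leg (target i) ∘ arrow i ≈ leg (source i)

    record Colimit : Set (o ⊔ ℓ ⊔ e) where
      field
        cocone : Cocone
      open Cocone cocone public
      field
        mediate     : (K : Cocone) → apex ⇒ Cocone.apex K
        mediate-leg : ∀ (K : Cocone) v → mediate K ∘ leg v ≈ Cocone.leg K v
        unique      : ∀ {Z} {h k : apex ⇒ Z} → (∀ v → h ∘ leg v ≈ k ∘ leg v) → h ≈ k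

  discrete : ∀ {n} → (Fin n → Obj) → FiniteDiagram
  discrete {n} A = record
    { vertices = n
    ; edges    = 0
    ; source   = λ i → ⊥-elim (¬Fin0 i)
    ; target   = λ i → ⊥-elim (¬Fin0 i)
    ; obj      = A
    ; arrow    = λ ()
    }

  parallel : ∀ {n A B} → (Fin n → A ⇒ B) → FiniteDiagram
  parallel {n} {A} {B} f = record
    { vertices = 2
    ; edges    = n
    ; source   = λ _ → zero
    ; target   = λ _ → suc zero
    ; obj      = λ { zero → A ; (suc _) → B }
    ; arrow    = f
    }

record FiniteColimits {o ℓ e} (C : Category o ℓ e) : Set (o ⊔ ℓ ⊔ e) where
  open Category C
  field
    colimit : ∀ (D : FiniteDiagram C) → Colimit C D

  ∐ : ∀ {n} → (Fin n → Obj) → Obj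
  ∐ A = Colimit.apex (colimit (discrete C A))

  ι : ∀ {n} {A : Fin n → Obj} i → A i ⇒ ∐ A
  ι {A = A} = Colimit.leg (colimit (discrete C A))

  [_] : ∀ {n} {A : Fin n → Obj} {B} → (∀ i → A i ⇒ B) → ∐ A ⇒ B
  [_] {A = A} f = Colimit.mediate (colimit (discrete C A)) (record { leg = f ; commute = λ () })

  -- The name is justified by `coeq-isCoequaliser`.
  module _ {n A B} (f : Fin n → A ⇒ B) where
    coeqObj : Obj
    coeqObj = Colimit.apex (colimit (parallel C f))

    coeq : B ⇒ coeqObj
    coeq = Colimit.leg (colimit (parallel C f)) (suc zero)

  private
    first : ∀ n .{{_ : NonZero n}} → Fin n
    first (suc n) = zero

  coeq-isCoequaliser : ∀ {n A B} .{{_ : NonZero n}} (f : Fin n → A ⇒ B) →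
                       IsCoequaliser f (coeq f)
  coeq-isCoequaliser {n} {A} {B} f = record
    { equalises = λ i j → ≈.trans (L.commute i) (≈.sym (L.commute j))
    ; mediate   = λ h eq → L.mediate (cocone h eq)
    ; mediate-∘ = λ h eq → L.mediate-leg (cocone h eq) (suc zero)
    ; unique    = λ {_} {h} {k} eq → L.unique λ
        { zero →
            ≈.trans (∘-resp-≈ ≈.refl (≈.sym (L.commute i₀)))
            (≈.trans (≈.sym assoc)
            (≈.trans (∘-resp-≈ eq ≈.refl)
            (≈.trans assoc
            (∘-resp-≈ ≈.refl (L.commute i₀)))))
        ; (suc zero) → eq
        }
    }
    where
    module L = Colimit (colimit (parallel C f))
    i₀ = first n
    cocone : ∀ {Z} (h : B ⇒ Z) → (∀ i j → h ∘ f i ≈ h ∘ f j) → Cocone C (parallel C f)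
    cocone h eq = record
      { leg     = λ { zero → h ∘ f i₀ ; (suc zero) → h }
      ; commute = λ i → eq i i₀
      }

-- Determinism of coprojections is only required for diagrams of deterministic
-- maps: the colimit of A --f--> B is B, with coprojection f at A, so that
-- without this proviso every map would be deterministic.
record DeterministicColimits {o ℓ e} {C : Category o ℓ e} {S : SymmetricMonoidal C}
                             (M : Markov S) (F : FiniteColimits C) : Set (o ⊔ ℓ ⊔ e) where
  open Category C
  open Markov M
  open FiniteColimits F
  field
    leg-det : ∀ (D : FiniteDiagram C) → (∀ i → Deterministic (FiniteDiagram.arrow D i)) →
              ∀ v → Deterministic (Colimit.leg (colimit D) v)
    mediate-det : ∀ (D : FiniteDiagram C) → (∀ i → Deterministic (FiniteDiagram.arrow D i)) →
                  ∀ (K : Cocone C D) → (∀ v → Deterministic (Cocone.leg K v)) →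
                  Deterministic (Colimit.mediate (colimit D) K)

-- Distributivity in the other argument follows by symmetry.
record Distributive {o ℓ e} {C : Category o ℓ e}
                    (S : SymmetricMonoidal C) (F : FiniteColimits C) : Set (o ⊔ ℓ ⊔ e) where
  open Category C
  open SymmetricMonoidal S
  open FiniteColimits F

  distribute : ∀ {n} {A : Obj} {B : Fin n → Obj} → ∐ (λ i → A ⊗₀ B i) ⇒ A ⊗₀ ∐ B
  distribute = [ (λ i → id ⊗₁ ι i) ]

  field
    distribute-isIso : ∀ {n} {A : Obj} {B : Fin n → Obj} → IsIso (distribute {n} {A} {B})

  undistribute : ∀ {n} {A : Obj} {B : Fin n → Obj} → A ⊗₀ ∐ B ⇒ ∐ (λ i → A ⊗₀ B i)
  undistribute = IsIso.inv distribute-isIso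

record Uniform {o ℓ e} {C : Category o ℓ e}
               (S : SymmetricMonoidal C) (F : FiniteColimits C) : Set (ℓ ⊔ e) where
  open Category C
  open SymmetricMonoidal S
  open FiniteColimits F

  ⟦_⟧ : ℕ → Obj
  ⟦ n ⟧ = ∐ {n} (λ _ → unit)

  ⟦_⟧ₚ : ∀ {n} → Permutation′ n → ⟦ n ⟧ ⇒ ⟦ n ⟧
  ⟦ σ ⟧ₚ = [ (λ i → ι (σ ⟨$⟩ʳ i)) ]

  -- Given distributivity, this canonical map is an isomorphism.
  pair : ∀ m n → ⟦ m * n ⟧ ⇒ ⟦ m ⟧ ⊗₀ ⟦ n ⟧
  pair m n = [ (λ k → (ι (proj₁ (remQuot {m} n k)) ⊗₁ ι (proj₂ (remQuot {m} n k))) ∘ unitˡ⇐) ]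

  field
    u         : ∀ n .{{_ : NonZero n}} → unit ⇒ ⟦ n ⟧
    u-permute : ∀ n .{{_ : NonZero n}} (σ : Permutation′ n) → ⟦ σ ⟧ₚ ∘ u n ≈ u n
    u-⊗       : ∀ m n .{{_ : NonZero m}} .{{_ : NonZero n}} →
                (u m ⊗₁ u n) ∘ unitˡ⇐ ≈ pair m n ∘ u (m * n) {{m*n≢0 m n}}

record UniformMarkovCategory o ℓ e : Set (lsuc (o ⊔ ℓ ⊔ e)) where
  field
    category              : Category o ℓ e
    symmetricMonoidal     : SymmetricMonoidal category
    markov                : Markov symmetricMonoidal
    finiteColimits        : FiniteColimits category
    deterministicColimits : DeterministicColimits markov finiteColimits
    distributive          : Distributive symmetricMonoidal finiteColimits
    uniform               : Uniform symmetricMonoidal finiteColimits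

  open Category category public
  open SymmetricMonoidal symmetricMonoidal public
  open Markov markov public
  open FiniteColimits finiteColimits public
  open DeterministicColimits deterministicColimits public
  open Distributive distributive public
  open Uniform uniform public

  convexSum : ∀ {n A B} → unit ⇒ ⟦ n ⟧ → (Fin n → A ⇒ B) → A ⇒ B
  convexSum r f = [ (λ i → f i ∘ unitʳ⇒) ] ∘ undistribute ∘ (id ⊗₁ r) ∘ unitʳ⇐

module _ {o ℓ e} (C : Category o ℓ e) where
  open Category C

  coerce : ∀ (T : ℕ → Obj → Obj) {m n A} → m ≡ n → T m A ⇒ T n A
  coerce T {m} {A = A} eq = subst (λ k → T m A ⇒ T k A) eq id

  record IsGradedMonad (T₀ : ℕ → Obj → Obj)
                       (T₁ : ∀ K {A B} → A ⇒ B → T₀ K A ⇒ T₀ K B)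
                       (η  : ∀ A → A ⇒ T₀ 1 A)
                       (μ  : ∀ K L A → T₀ K (T₀ L A) ⇒ T₀ (K * L) A) : Set (o ⊔ ℓ ⊔ e) where
    field
      resp-≈       : ∀ K {A B} {f g : A ⇒ B} → f ≈ g → T₁ K f ≈ T₁ K g
      identity     : ∀ K {A} → T₁ K (id {A}) ≈ id
      homomorphism : ∀ K {A B C} {f : A ⇒ B} {g : B ⇒ C} → T₁ K (g ∘ f) ≈ T₁ K g ∘ T₁ K f

      η-natural : ∀ {A B} (f : A ⇒ B) → η B ∘ f ≈ T₁ 1 f ∘ η A
      μ-natural : ∀ K L {A B} (f : A ⇒ B) → μ K L B ∘ T₁ K (T₁ L f) ≈ T₁ (K * L) f ∘ μ K L A

      μ-identityˡ : ∀ K A → coerce T₀ (*-identityˡ K) ∘ μ 1 K A ∘ η (T₀ K A) ≈ id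
      μ-identityʳ : ∀ K A → coerce T₀ (*-identityʳ K) ∘ μ K 1 A ∘ T₁ K (η A) ≈ id
      μ-assoc     : ∀ K L N A → coerce T₀ (*-assoc K L N) ∘ μ (K * L) N A ∘ μ K L (T₀ N A)
                                ≈ μ K (L * N) A ∘ T₁ K (μ L N A)

-- Every permutation of 1 + n elements is determined by the image of zero and
-- a permutation of the remaining n elements.
enumerate : ∀ n → Fin (n !) → Permutation′ n
enumerate zero    _ = Perm.id
enumerate (suc n) k =
  insert zero (proj₁ (remQuot {suc n} (n !) k)) (enumerate n (proj₂ (remQuot {suc n} (n !) k)))

remove-cong : ∀ {n} (π ρ : Permutation′ (suc n)) → π Perm.≈ ρ → remove zero π Perm.≈ remove zero ρ
remove-cong π ρ eq j = punchIn-injective (π ⟨$⟩ʳ zero) _ _ (begin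
  punchIn (π ⟨$⟩ʳ zero) (remove zero π ⟨$⟩ʳ j) ≡⟨ Perm.punchIn-permute π zero j ⟨
  π ⟨$⟩ʳ suc j                                 ≡⟨ eq (suc j) ⟩
  ρ ⟨$⟩ʳ suc j                                 ≡⟨ Perm.punchIn-permute ρ zero j ⟩
  punchIn (ρ ⟨$⟩ʳ zero) (remove zero ρ ⟨$⟩ʳ j) ≡⟨ cong (λ i → punchIn i (remove zero ρ ⟨$⟩ʳ j)) (eq zero) ⟨
  punchIn (π ⟨$⟩ʳ zero) (remove zero ρ ⟨$⟩ʳ j) ∎)
  where open ≡.≡-Reasoning

insert-cong : ∀ {n} (i : Fin (suc n)) {π ρ : Permutation′ n} → π Perm.≈ ρ →
              insert zero i π Perm.≈ insert zero i ρ
insert-cong i         eq zero    = refl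
insert-cong i {π} {ρ} eq (suc j) = ≡.trans (insert-punchIn zero i π j)
  (≡.trans (cong (punchIn i) (eq j)) (≡.sym (insert-punchIn zero i ρ j)))

enumerate-surjective : ∀ n (π : Permutation′ n) → ∃[ k ] enumerate n k Perm.≈ π
enumerate-surjective zero    π = zero , λ ()
enumerate-surjective (suc n) π with enumerate-surjective n (remove zero π)
... | k , eq = combine (π ⟨$⟩ʳ zero) k , λ j → ≡.trans (lemma j) (≡.trans
        (insert-cong (π ⟨$⟩ʳ zero) {enumerate n k} {remove zero π} eq j)
        (insert-remove zero π j))
  where
  lemma : enumerate (suc n) (combine (π ⟨$⟩ʳ zero) k)
          Perm.≈ insert zero (π ⟨$⟩ʳ zero) (enumerate n k)
  lemma j = cong (λ ik → insert zero (proj₁ ik) (enumerate n (proj₂ ik)) ⟨$⟩ʳ j)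
                 (remQuot-combine (π ⟨$⟩ʳ zero) k)

enumerate-injective : ∀ n (k l : Fin (n !)) → enumerate n k Perm.≈ enumerate n l → k ≡ l
enumerate-injective zero    zero zero _  = refl
enumerate-injective (suc n) k    l    eq = begin
  k                                     ≡⟨ combine-remQuot {suc n} (n !) k ⟨
  combine (proj₁ (rq k)) (proj₂ (rq k)) ≡⟨ ≡.cong₂ combine (eq zero) tails ⟩
  combine (proj₁ (rq l)) (proj₂ (rq l)) ≡⟨ combine-remQuot {suc n} (n !) l ⟩
  l                                     ∎
  where
  open ≡.≡-Reasoning
  rq = remQuot {suc n} (n !)
  tails : proj₂ (rq k) ≡ proj₂ (rq l)
  tails = enumerate-injective n _ _ λ j → begin
    enumerate n (proj₂ (rq k)) ⟨$⟩ʳ j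
      ≡⟨ remove-insert zero (proj₁ (rq k)) (enumerate n (proj₂ (rq k))) j ⟨
    remove zero (enumerate (suc n) k) ⟨$⟩ʳ j
      ≡⟨ remove-cong (enumerate (suc n) k) (enumerate (suc n) l) eq j ⟩
    remove zero (enumerate (suc n) l) ⟨$⟩ʳ j
      ≡⟨ remove-insert zero (proj₁ (rq l)) (enumerate n (proj₂ (rq l))) j ⟩
    enumerate n (proj₂ (rq l)) ⟨$⟩ʳ j ∎

module Multisets {o ℓ e} (𝐂 : UniformMarkovCategory o ℓ e) where
  open UniformMarkovCategory 𝐂

  infixr 11 _^_ _^₁_

  -- X ^ 1 is X ⊗₀ unit.
  _^_ : Obj → ℕ → Obj
  X ^ zero  = unit
  X ^ suc K = X ⊗₀ X ^ K

  _^₁_ : ∀ {X Y} → X ⇒ Y → ∀ K → X ^ K ⇒ Y ^ K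
  f ^₁ zero  = id
  f ^₁ suc K = f ⊗₁ f ^₁ K

  ++ : ∀ K L {X} → X ^ K ⊗₀ X ^ L ⇒ X ^ (K + L)
  ++ zero    L = unitˡ⇒
  ++ (suc K) L = (id ⊗₁ ++ K L) ∘ assoc⇒

  -- Moves the i-th factor to the front.
  extract : ∀ {K X} → Fin (suc K) → X ^ suc K ⇒ X ^ suc K
  extract         zero    = id
  extract {suc K} (suc i) = exchange ∘ (id ⊗₁ extract i)

  -- The j-th factor of the output is the (σ ⟨$⟩ʳ j)-th factor of the input.
  permute : ∀ {K X} → Permutation′ K → X ^ K ⇒ X ^ K
  permute {zero}  σ = id
  permute {suc K} σ = (id ⊗₁ permute (remove zero σ)) ∘ extract (σ ⟨$⟩ʳ zero)

  M₀ : ℕ → Obj → Obj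
  M₀ K X = coeqObj (λ k → permute {K} {X} (enumerate K k))

  acc : ∀ K {X} → X ^ K ⇒ M₀ K X
  acc K = coeq (λ k → permute (enumerate K k))

  private
    infixr 5 _⟩_
    _⟩_ : ∀ {A B} {f g h : A ⇒ B} → f ≈ g → g ≈ h → f ≈ h
    _⟩_ = ≈.trans

    infixr 6 _⟩∘⟨_
    _⟩∘⟨_ : ∀ {A B C} {f f′ : B ⇒ C} {g g′ : A ⇒ B} → f ≈ f′ → g ≈ g′ → f ∘ g ≈ f′ ∘ g′
    _⟩∘⟨_ = ∘-resp-≈

  permute-cong : ∀ {K X} {σ τ : Permutation′ K} → σ Perm.≈ τ → permute {K} {X} σ ≈ permute τ
  permute-cong {zero}              eq = ≈.refl
  permute-cong {suc K} {σ = σ} {τ} eq =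
    ⊗-resp-≈ ≈.refl (permute-cong {σ = remove zero σ} {remove zero τ} (remove-cong σ τ eq))
    ⟩∘⟨ ≈.reflexive (cong extract (eq zero))

  acc-isCoequaliser : ∀ K X → IsCoequaliser (permute {K} {X}) (acc K)
  acc-isCoequaliser K X = record
    { equalises = λ σ τ →
        let k , k≈σ = enumerate-surjective K σ
            l , l≈τ = enumerate-surjective K τ
        in ≈.refl ⟩∘⟨ ≈.sym (permute-cong {σ = enumerate K k} {σ} k≈σ) ⟩
           Q.equalises k l ⟩
           ≈.refl ⟩∘⟨ permute-cong {σ = enumerate K l} {τ} l≈τ
    ; mediate   = λ h eq → Q.mediate h (λ k l → eq (enumerate K k) (enumerate K l))
    ; mediate-∘ = λ h eq → Q.mediate-∘ h (λ k l → eq (enumerate K k) (enumerate K l))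
    ; unique    = Q.unique
    }
    where
    module Q = IsCoequaliser
      (coeq-isCoequaliser {{K !≢0}} (λ k → permute {K} {X} (enumerate K k)))

  assoc⇐-natural : ∀ {A B C A′ B′ C′} {f : A ⇒ A′} {g : B ⇒ B′} {h : C ⇒ C′} →
                   assoc⇐ ∘ (f ⊗₁ (g ⊗₁ h)) ≈ ((f ⊗₁ g) ⊗₁ h) ∘ assoc⇐
  assoc⇐-natural =
    ≈.sym identityʳ ⟩ ≈.refl ⟩∘⟨ ≈.sym assoc-isoʳ ⟩ assoc ⟩
    ≈.refl ⟩∘⟨ (≈.sym assoc ⟩ ≈.sym assoc-natural ⟩∘⟨ ≈.refl ⟩ assoc) ⟩
    ≈.sym assoc ⟩ assoc-isoˡ ⟩∘⟨ ≈.refl ⟩ identityˡ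

  exchange-natural : ∀ {A B C A′ B′ C′} {f : A ⇒ A′} {g : B ⇒ B′} {h : C ⇒ C′} →
                     exchange ∘ (f ⊗₁ (g ⊗₁ h)) ≈ (g ⊗₁ (f ⊗₁ h)) ∘ exchange
  exchange-natural =
    assoc ⟩ ≈.refl ⟩∘⟨ (assoc ⟩ ≈.refl ⟩∘⟨ assoc⇐-natural ⟩ ≈.sym assoc ⟩
      (≈.sym ⊗-∘ ⟩ ⊗-resp-≈ braid-natural (identityˡ ⟩ ≈.sym identityʳ) ⟩ ⊗-∘) ⟩∘⟨ ≈.refl ⟩
      assoc) ⟩
    ≈.sym assoc ⟩ assoc-natural ⟩∘⟨ ≈.refl ⟩ assoc

  id⊗-natural : ∀ {A A′ B C B′ C′} {f : A ⇒ A′} {g : B ⇒ C} {h : B ⇒ B′} {g′ : B′ ⇒ C′} {h′ : C ⇒ C′} →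
                g′ ∘ h ≈ h′ ∘ g → (id ⊗₁ g′) ∘ (f ⊗₁ h) ≈ (f ⊗₁ h′) ∘ (id ⊗₁ g)
  id⊗-natural eq = ≈.sym ⊗-∘ ⟩ ⊗-resp-≈ (identityˡ ⟩ ≈.sym identityʳ) eq ⟩ ⊗-∘

  extract-natural : ∀ {K X Y} (f : X ⇒ Y) (i : Fin (suc K)) →
                    extract i ∘ f ^₁ suc K ≈ f ^₁ suc K ∘ extract i
  extract-natural         f zero    = identityˡ ⟩ ≈.sym identityʳ
  extract-natural {suc K} f (suc i) =
    assoc ⟩ ≈.refl ⟩∘⟨ id⊗-natural (extract-natural f i) ⟩
    ≈.sym assoc ⟩ exchange-natural ⟩∘⟨ ≈.refl ⟩ assoc

  permute-natural : ∀ {K X Y} (f : X ⇒ Y) (σ : Permutation′ K) →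
                    permute σ ∘ f ^₁ K ≈ f ^₁ K ∘ permute σ
  permute-natural {zero}  f σ = ≈.refl
  permute-natural {suc K} f σ =
    assoc ⟩ ≈.refl ⟩∘⟨ extract-natural f (σ ⟨$⟩ʳ zero) ⟩
    ≈.sym assoc ⟩ id⊗-natural (permute-natural f (remove zero σ)) ⟩∘⟨ ≈.refl ⟩ assoc

  M₁-equalises : ∀ K {X Y} (f : X ⇒ Y) (σ τ : Permutation′ K) →
                 (acc K ∘ f ^₁ K) ∘ permute σ ≈ (acc K ∘ f ^₁ K) ∘ permute τ
  M₁-equalises K {Y = Y} f σ τ =
    slide σ ⟩ IsCoequaliser.equalises (acc-isCoequaliser K Y) σ τ ⟩∘⟨ ≈.refl ⟩ ≈.sym (slide τ)
    where
    slide : ∀ σ → (acc K ∘ f ^₁ K) ∘ permute σ ≈ (acc K ∘ permute σ) ∘ f ^₁ K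
    slide σ = assoc ⟩ ≈.refl ⟩∘⟨ ≈.sym (permute-natural f σ) ⟩ ≈.sym assoc

  M₁ : ∀ K {X Y} → X ⇒ Y → M₀ K X ⇒ M₀ K Y
  M₁ K {X} f = IsCoequaliser.mediate (acc-isCoequaliser K X) (acc K ∘ f ^₁ K) (M₁-equalises K f)

  M₁-acc : ∀ K {X Y} (f : X ⇒ Y) → M₁ K f ∘ acc K ≈ acc K ∘ f ^₁ K
  M₁-acc K {X} f =
    IsCoequaliser.mediate-∘ (acc-isCoequaliser K X) (acc K ∘ f ^₁ K) (M₁-equalises K f)

  perm : ∀ K {X} → X ^ K ⇒ X ^ K
  perm K {X} = convexSum (u (K !) {{K !≢0}}) (λ k → permute {K} {X} (enumerate K k))

  -- Since `acc` is epic, there is at most one such `arr`, up to `_≈_`.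
  record Arrangement : Set (o ⊔ ℓ ⊔ e) where
    field
      arr     : ∀ K {X} → M₀ K X ⇒ X ^ K
      arr-acc : ∀ K {X} → arr K {X} ∘ acc K ≈ perm K

  η : ∀ X → X ⇒ M₀ 1 X
  η X = acc 1 ∘ unitʳ⇐

  TensorsOfAccAreCoequalisers : Set (o ⊔ ℓ ⊔ e)
  TensorsOfAccAreCoequalisers = ∀ K L X →
    IsCoequaliser {I = Permutation′ K × Permutation′ L}
                  (λ (σ , τ) → permute {K} {X} σ ⊗₁ permute {L} {X} τ)
                  (acc K ⊗₁ acc L)

  module Sums (A : Arrangement) where
    open Arrangement A

    plus : ∀ K L {X} → M₀ K X ⊗₀ M₀ L X ⇒ M₀ (K + L) X
    plus K L = acc (K + L) ∘ ++ K L ∘ (arr K ⊗₁ arr L)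

    sum : ∀ K L {X} → M₀ L X ^ K ⇒ M₀ (K * L) X
    sum 0             L {X} = acc 0 {X}
    sum 1             L     = coerce category M₀ (≡.sym (*-identityˡ L)) ∘ unitʳ⇒
    sum (suc (suc K)) L     = plus L (suc K * L) ∘ (id ⊗₁ sum (suc K) L)

    -- Since `acc` is epic, there is at most one such `μ`, up to `_≈_`.
    record Multiplication : Set (o ⊔ ℓ ⊔ e) where
      field
        μ     : ∀ K L X → M₀ K (M₀ L X) ⇒ M₀ (K * L) X
        μ-acc : ∀ K L X → μ K L X ∘ acc K {M₀ L X} ≈ sum K L {X}

module Submission where

open import Defs
open import Data.Fin using (Fin; zero; suc; punchIn)
open import Data.Fin.Permutation as Perm
  using (Permutation′; _⟨$⟩ʳ_; _∘ₚ_; flip; lift₀; remove; permutation; inverseˡ; inverseʳ;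
         punchIn-permute)
open import Data.Fin.Properties using (punchIn-injective; suc-injective)
open import Data.Nat using (ℕ; zero; suc; _+_; _*_; _!)
open import Data.Nat.Properties using (_!≢0; *-identityˡ; *-identityʳ; *-assoc)
open import Data.Product using (_×_; _,_; proj₁; proj₂)
open import Relation.Binary.Bundles using (Setoid)
open import Relation.Binary.PropositionalEquality as ≡ using (_≡_; refl; cong)
import Relation.Binary.Reasoning.Setoid as SetoidReasoning

-- A convex sum of copies of f is f, so acc ∘ perm ≈ acc and hence
-- acc ∘ arr ≈ id: every acc K is a split epimorphism, and so are all tensors
-- and tensor powers of such maps. Each claim about plus, sum and μ can
-- therefore be checked after precomposition with tensors of accs, where it
-- becomes a claim about concatenations of tuples, up to a permutation of the
-- factors that the outer acc absorbs.
--
-- Permutations of factors are handled as words in adjacent exchanges; that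
-- permute σ composed with such a word is again of the form permute τ rests on
-- the Yang–Baxter equation for exchange.

-- Two obstacles shape the proof. `permute` recurses on the image of zero, so neither its
-- functoriality nor its behaviour under `++` can be read off. The generators of words are local, so
-- claims about concatenation can be checked one generator at a time. Genuine permutations return
-- where `perm` is averaged: composing with a word translates the symmetric group, and `u (K !)` is
-- invariant under the resulting permutation of indices. Secondly, `(K * L) * N` and `K * (L * N)`
-- are different indices, so the tensor powers they name have different types. The relation
-- `_∣_∣_⊢_∼_` carries a word and an equality of sizes through a chain of steps; `acc` erases the
-- word and leaves precisely the `coerce` of the graded monad laws.

-- Rewriting of composites

module Composition {o ℓ e} (C : Category o ℓ e) where
  open Category C

  hom : Obj → Obj → Setoid ℓ e
  hom A B = record { isEquivalence = ≈-equiv {A} {B} }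

  open module HomReasoning {A} {B} = SetoidReasoning (hom A B) public

  private variable
    A B D E : Obj
    f g h k a b : A ⇒ B

  infix  4 refl⟩∘⟨_
  infix  5 _⟩∘⟨refl

  refl⟩∘⟨_ : g ≈ h → f ∘ g ≈ f ∘ h
  refl⟩∘⟨_ = ∘-resp-≈ ≈.refl

  _⟩∘⟨refl : f ≈ g → f ∘ h ≈ g ∘ h
  eq ⟩∘⟨refl = ∘-resp-≈ eq ≈.refl

  pullˡ : f ∘ g ≈ a → f ∘ g ∘ h ≈ a ∘ h
  pullˡ eq = ≈.trans (≈.sym assoc) (eq ⟩∘⟨refl)

  pushˡ : a ≈ f ∘ g → a ∘ h ≈ f ∘ g ∘ h
  pushˡ eq = ≈.sym (pullˡ (≈.sym eq))

  pullʳ : g ∘ h ≈ a → (f ∘ g) ∘ h ≈ f ∘ a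
  pullʳ eq = ≈.trans assoc (refl⟩∘⟨ eq)

  pushʳ : a ≈ g ∘ h → f ∘ a ≈ (f ∘ g) ∘ h
  pushʳ eq = ≈.sym (pullʳ (≈.sym eq))

  extendʳ : f ∘ g ≈ a ∘ b → f ∘ g ∘ h ≈ a ∘ b ∘ h
  extendʳ eq = ≈.trans (pullˡ eq) assoc

  cancelˡ : f ∘ g ≈ id → f ∘ g ∘ h ≈ h
  cancelˡ eq = ≈.trans (pullˡ eq) identityˡ

  cancelʳ : f ∘ g ≈ id → (h ∘ f) ∘ g ≈ h
  cancelʳ eq = ≈.trans (pullʳ eq) identityʳ

  switch-fromtoˡ : g ∘ f ≈ id → f ∘ h ≈ k → h ≈ g ∘ k
  switch-fromtoˡ inv eq = ≈.trans (≈.sym (cancelˡ inv)) (refl⟩∘⟨ eq)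

  split-epi : ∀ {q : A ⇒ B} {s : B ⇒ A} {h k : B ⇒ D} → q ∘ s ≈ id → h ∘ q ≈ k ∘ q → h ≈ k
  split-epi split eq = ≈.trans (≈.sym (cancelʳ split)) (≈.trans (eq ⟩∘⟨refl) (cancelʳ split))

  split-mono : ∀ {q : A ⇒ B} {s : B ⇒ A} {h k : D ⇒ A} → s ∘ q ≈ id → q ∘ h ≈ q ∘ k → h ≈ k
  split-mono split eq = ≈.trans (≈.sym (cancelˡ split)) (≈.trans (refl⟩∘⟨ eq) (cancelˡ split))

-- Consequences of the symmetric monoidal axioms

module Coherence {o ℓ e} {C : Category o ℓ e} (S : SymmetricMonoidal C) where
  open Category C
  open SymmetricMonoidal S
  open Composition C

  private variable
    A B D E : Obj
    f g h : A ⇒ B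

  infixr 5 id⊗-cong_ _⊗id-cong

  id⊗-cong_ : f ≈ g → id {A} ⊗₁ f ≈ id ⊗₁ g
  id⊗-cong_ = ⊗-resp-≈ ≈.refl

  _⊗id-cong : f ≈ g → f ⊗₁ id {A} ≈ g ⊗₁ id
  eq ⊗id-cong = ⊗-resp-≈ eq ≈.refl

  id⊗-∘ : (id ⊗₁ f) ∘ (h ⊗₁ g) ≈ h ⊗₁ (f ∘ g)
  id⊗-∘ = ≈.trans (≈.sym ⊗-∘) (⊗-resp-≈ identityˡ ≈.refl)

  ⊗id-∘ : (f ⊗₁ id) ∘ (g ⊗₁ h) ≈ (f ∘ g) ⊗₁ h
  ⊗id-∘ = ≈.trans (≈.sym ⊗-∘) (⊗-resp-≈ ≈.refl identityˡ)

  ⊗-slide : (f ⊗₁ id) ∘ (id ⊗₁ g) ≈ (id ⊗₁ g) ∘ (f ⊗₁ id)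
  ⊗-slide = ≈.trans (≈.sym ⊗-∘) (≈.trans
    (⊗-resp-≈ (≈.trans identityʳ (≈.sym identityˡ)) (≈.trans identityˡ (≈.sym identityʳ))) ⊗-∘)

  unitʳ⇐-natural : {f : A ⇒ B} → unitʳ⇐ ∘ f ≈ (f ⊗₁ id) ∘ unitʳ⇐
  unitʳ⇐-natural = ≈.sym (switch-fromtoˡ unitʳ-isoˡ
    (≈.trans (pullˡ unitʳ-natural) (cancelʳ unitʳ-isoʳ)))

  -- `unitˡ⇒` is a natural isomorphism from tensoring with the unit to the identity functor. Like
  -- `⊗unit-faithful`, this lets an extra unit be tensored to an equation, which makes room for the
  -- pentagon and the hexagon below.
  unit⊗-faithful : id {unit} ⊗₁ f ≈ id ⊗₁ g → f ≈ g
  unit⊗-faithful {f = f} {g = g} eq = split-epi unitˡ-isoʳ (begin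
    f ∘ unitˡ⇒         ≈⟨ unitˡ-natural ⟨
    unitˡ⇒ ∘ id ⊗₁ f   ≈⟨ refl⟩∘⟨ eq ⟩
    unitˡ⇒ ∘ id ⊗₁ g   ≈⟨ unitˡ-natural ⟩
    g ∘ unitˡ⇒         ∎)

  ⊗unit-faithful : f ⊗₁ id {unit} ≈ g ⊗₁ id → f ≈ g
  ⊗unit-faithful {f = f} {g = g} eq = split-epi unitʳ-isoʳ (begin
    f ∘ unitʳ⇒         ≈⟨ unitʳ-natural ⟨
    unitʳ⇒ ∘ f ⊗₁ id   ≈⟨ refl⟩∘⟨ eq ⟩
    unitʳ⇒ ∘ g ⊗₁ id   ≈⟨ unitʳ-natural ⟩
    g ∘ unitʳ⇒         ∎)

  assoc⇒⊗id-split : (assoc⇒ {A} {B} {D} ⊗₁ id {E}) ∘ (assoc⇐ ⊗₁ id) ≈ id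
  assoc⇒⊗id-split = ≈.trans ⊗id-∘ (≈.trans (assoc-isoʳ ⊗id-cong) ⊗-id)

  assoc-assoc⊗id-epi : ∀ {Z} {h k : A ⊗₀ ((B ⊗₀ D) ⊗₀ E) ⇒ Z} →
    h ∘ assoc⇒ ∘ (assoc⇒ ⊗₁ id) ≈ k ∘ assoc⇒ ∘ (assoc⇒ ⊗₁ id) → h ≈ k
  assoc-assoc⊗id-epi eq = split-epi assoc-isoʳ (split-epi assoc⇒⊗id-split
    (≈.trans assoc (≈.trans eq (≈.sym assoc))))

  -- Kelly's argument: the pentagon at `unit`, `unit`, `A`, `B` and two uses of the triangle give
  -- the equation tensored with the unit, up to precomposition with isomorphisms.
  unitˡ-assoc : unitˡ⇒ ∘ assoc⇒ {unit} {A} {B} ≈ unitˡ⇒ ⊗₁ id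
  unitˡ-assoc = unit⊗-faithful (assoc-assoc⊗id-epi (begin
    (id ⊗₁ (unitˡ⇒ ∘ assoc⇒)) ∘ assoc⇒ ∘ (assoc⇒ ⊗₁ id)        ≈⟨ pushˡ (≈.sym id⊗-∘) ⟩
    (id ⊗₁ unitˡ⇒) ∘ (id ⊗₁ assoc⇒) ∘ assoc⇒ ∘ (assoc⇒ ⊗₁ id)  ≈⟨ refl⟩∘⟨ pentagon ⟩
    (id ⊗₁ unitˡ⇒) ∘ assoc⇒ ∘ assoc⇒                          ≈⟨ pullˡ triangle ⟩
    (unitʳ⇒ ⊗₁ id) ∘ assoc⇒                                   ≈⟨ ⊗-resp-≈ ≈.refl ⊗-id ⟩∘⟨refl ⟨
    (unitʳ⇒ ⊗₁ (id ⊗₁ id)) ∘ assoc⇒                           ≈⟨ assoc-natural ⟨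
    assoc⇒ ∘ ((unitʳ⇒ ⊗₁ id) ⊗₁ id)                           ≈⟨ refl⟩∘⟨ ≈.trans ⊗id-∘ (triangle ⊗id-cong) ⟨
    assoc⇒ ∘ ((id ⊗₁ unitˡ⇒) ⊗₁ id) ∘ (assoc⇒ ⊗₁ id)           ≈⟨ extendʳ assoc-natural ⟩
    (id ⊗₁ (unitˡ⇒ ⊗₁ id)) ∘ assoc⇒ ∘ (assoc⇒ ⊗₁ id)           ∎))

  assoc-unitʳ : (id ⊗₁ unitʳ⇒) ∘ assoc⇒ {A} {B} ≈ unitʳ⇒
  assoc-unitʳ = ⊗unit-faithful (split-mono assoc-isoˡ (begin
    assoc⇒ ∘ (((id ⊗₁ unitʳ⇒) ∘ assoc⇒) ⊗₁ id)                   ≈⟨ refl⟩∘⟨ ⊗id-∘ ⟨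
    assoc⇒ ∘ ((id ⊗₁ unitʳ⇒) ⊗₁ id) ∘ (assoc⇒ ⊗₁ id)             ≈⟨ extendʳ assoc-natural ⟩
    (id ⊗₁ (unitʳ⇒ ⊗₁ id)) ∘ assoc⇒ ∘ (assoc⇒ ⊗₁ id)             ≈⟨ ≈.trans id⊗-∘ (id⊗-cong triangle) ⟩∘⟨refl ⟨
    ((id ⊗₁ (id ⊗₁ unitˡ⇒)) ∘ (id ⊗₁ assoc⇒)) ∘ assoc⇒ ∘ (assoc⇒ ⊗₁ id) ≈⟨ pullʳ pentagon ⟩
    (id ⊗₁ (id ⊗₁ unitˡ⇒)) ∘ assoc⇒ ∘ assoc⇒                     ≈⟨ extendʳ (≈.sym assoc-natural) ⟩
    assoc⇒ ∘ ((id ⊗₁ id) ⊗₁ unitˡ⇒) ∘ assoc⇒                     ≈⟨ refl⟩∘⟨ (≈.trans (⊗-resp-≈ ⊗-id ≈.refl ⟩∘⟨refl) triangle) ⟩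
    assoc⇒ ∘ (unitʳ⇒ ⊗₁ id)                                     ∎))

  -- From the hexagon at `A`, `unit`, `unit`, once the outer invertible `braid` is cancelled.
  unitˡ-braid : unitˡ⇒ ∘ braid {A} ≈ unitʳ⇒
  unitˡ-braid = ⊗unit-faithful (split-mono braid-iso (begin
    braid ∘ ((unitˡ⇒ ∘ braid) ⊗₁ id)                 ≈⟨ refl⟩∘⟨ ⊗id-∘ ⟨
    braid ∘ (unitˡ⇒ ⊗₁ id) ∘ (braid ⊗₁ id)           ≈⟨ refl⟩∘⟨ unitˡ-assoc ⟩∘⟨refl ⟨
    braid ∘ (unitˡ⇒ ∘ assoc⇒) ∘ (braid ⊗₁ id)        ≈⟨ refl⟩∘⟨ assoc ⟩
    braid ∘ unitˡ⇒ ∘ assoc⇒ ∘ (braid ⊗₁ id)          ≈⟨ extendʳ unitˡ-natural ⟨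
    unitˡ⇒ ∘ (id ⊗₁ braid) ∘ assoc⇒ ∘ (braid ⊗₁ id)  ≈⟨ refl⟩∘⟨ hexagon ⟩
    unitˡ⇒ ∘ assoc⇒ ∘ braid ∘ assoc⇒                 ≈⟨ pullˡ unitˡ-assoc ⟩
    (unitˡ⇒ ⊗₁ id) ∘ braid ∘ assoc⇒                  ≈⟨ extendʳ braid-natural ⟨
    braid ∘ (id ⊗₁ unitˡ⇒) ∘ assoc⇒                  ≈⟨ refl⟩∘⟨ triangle ⟩
    braid ∘ (unitʳ⇒ ⊗₁ id)                           ∎))

  exchange-assoc : exchange {A} {B} {D} ∘ assoc⇒ ≈ assoc⇒ ∘ (braid ⊗₁ id)
  exchange-assoc = begin
    (assoc⇒ ∘ (braid ⊗₁ id) ∘ assoc⇐) ∘ assoc⇒  ≈⟨ assoc ⟩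
    assoc⇒ ∘ ((braid ⊗₁ id) ∘ assoc⇐) ∘ assoc⇒  ≈⟨ refl⟩∘⟨ cancelʳ assoc-isoˡ ⟩
    assoc⇒ ∘ (braid ⊗₁ id)                      ∎

  exchange-involutive : exchange ∘ exchange {A} {B} {D} ≈ id
  exchange-involutive = split-epi assoc-isoʳ (begin
    (exchange ∘ exchange) ∘ assoc⇒             ≈⟨ pullʳ exchange-assoc ⟩
    exchange ∘ assoc⇒ ∘ (braid ⊗₁ id)          ≈⟨ pullˡ exchange-assoc ⟩
    (assoc⇒ ∘ (braid ⊗₁ id)) ∘ (braid ⊗₁ id)   ≈⟨ cancelʳ (≈.trans ⊗id-∘ (≈.trans (braid-iso ⊗id-cong) ⊗-id)) ⟩
    assoc⇒                                     ≈⟨ identityˡ ⟨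
    id ∘ assoc⇒                                ∎)

  exchange-unitˡ : (id ⊗₁ unitˡ⇒) ∘ exchange {unit} {A} {B} ≈ unitˡ⇒
  exchange-unitˡ = split-epi assoc-isoʳ (begin
    ((id ⊗₁ unitˡ⇒) ∘ exchange) ∘ assoc⇒        ≈⟨ pullʳ exchange-assoc ⟩
    (id ⊗₁ unitˡ⇒) ∘ assoc⇒ ∘ (braid ⊗₁ id)     ≈⟨ pullˡ triangle ⟩
    (unitʳ⇒ ⊗₁ id) ∘ (braid ⊗₁ id)              ≈⟨ ⊗id-∘ ⟩
    (unitʳ⇒ ∘ braid) ⊗₁ id                      ≈⟨ ≈.trans (pushˡ (≈.sym unitˡ-braid)) (≈.trans (refl⟩∘⟨ braid-iso) identityʳ) ⊗id-cong ⟩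
    unitˡ⇒ ⊗₁ id                                ≈⟨ unitˡ-assoc ⟨
    unitˡ⇒ ∘ assoc⇒                             ∎)

  unitˡ-exchange : unitˡ⇒ ∘ exchange {A} {unit} {B} ≈ id ⊗₁ unitˡ⇒
  unitˡ-exchange = ≈.trans (pushˡ (≈.sym exchange-unitˡ))
    (≈.trans (refl⟩∘⟨ exchange-involutive) identityʳ)

  -- Two pentagons around the naturality of `assoc⇒`. It is used for a `swap` in the left argument
  -- of `++`.
  exchange⊗id : (id ⊗₁ assoc⇒) ∘ assoc⇒ ∘ (exchange {A} {B} {D} ⊗₁ id {E}) ≈
                exchange ∘ (id ⊗₁ assoc⇒) ∘ assoc⇒
  exchange⊗id = split-epi assoc⇒⊗id-split (begin
    ((id ⊗₁ assoc⇒) ∘ assoc⇒ ∘ (exchange ⊗₁ id)) ∘ (assoc⇒ ⊗₁ id)  ≈⟨ ≈.trans assoc (refl⟩∘⟨ assoc) ⟩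
    (id ⊗₁ assoc⇒) ∘ assoc⇒ ∘ (exchange ⊗₁ id) ∘ (assoc⇒ ⊗₁ id)
      ≈⟨ refl⟩∘⟨ refl⟩∘⟨ ≈.trans ⊗id-∘ (≈.trans (exchange-assoc ⊗id-cong) (≈.sym ⊗id-∘)) ⟩
    (id ⊗₁ assoc⇒) ∘ assoc⇒ ∘ (assoc⇒ ⊗₁ id) ∘ ((braid ⊗₁ id) ⊗₁ id)  ≈⟨ refl⟩∘⟨ assoc ⟨
    (id ⊗₁ assoc⇒) ∘ (assoc⇒ ∘ (assoc⇒ ⊗₁ id)) ∘ ((braid ⊗₁ id) ⊗₁ id)  ≈⟨ pullˡ pentagon ⟩
    (assoc⇒ ∘ assoc⇒) ∘ ((braid ⊗₁ id) ⊗₁ id)     ≈⟨ pullʳ assoc-natural ⟩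
    assoc⇒ ∘ (braid ⊗₁ (id ⊗₁ id)) ∘ assoc⇒       ≈⟨ refl⟩∘⟨ ⊗-resp-≈ ≈.refl ⊗-id ⟩∘⟨refl ⟩
    assoc⇒ ∘ (braid ⊗₁ id) ∘ assoc⇒               ≈⟨ extendʳ (≈.sym exchange-assoc) ⟩
    exchange ∘ assoc⇒ ∘ assoc⇒                    ≈⟨ refl⟩∘⟨ pentagon ⟨
    exchange ∘ (id ⊗₁ assoc⇒) ∘ assoc⇒ ∘ (assoc⇒ ⊗₁ id)    ≈⟨ ≈.trans assoc (refl⟩∘⟨ assoc) ⟨
    (exchange ∘ (id ⊗₁ assoc⇒) ∘ assoc⇒) ∘ (assoc⇒ ⊗₁ id)  ∎)

  -- The hexagon, tensored with `E` and rebracketed by pentagons: passing a product amounts to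
  -- passing its two factors in turn.
  exchange-⊗ʳ : assoc⇒ ∘ exchange {A} {B ⊗₀ D} {E} ≈
                (id ⊗₁ exchange) ∘ exchange ∘ (id ⊗₁ assoc⇒)
  exchange-⊗ʳ = assoc-assoc⊗id-epi (begin
    (assoc⇒ ∘ exchange) ∘ assoc⇒ ∘ (assoc⇒ ⊗₁ id)            ≈⟨ pullʳ (pullˡ exchange-assoc) ⟩
    assoc⇒ ∘ (assoc⇒ ∘ (braid ⊗₁ id)) ∘ (assoc⇒ ⊗₁ id)       ≈⟨ refl⟩∘⟨ assoc ⟩
    assoc⇒ ∘ assoc⇒ ∘ (braid ⊗₁ id) ∘ (assoc⇒ ⊗₁ id)         ≈⟨ assoc ⟨
    (assoc⇒ ∘ assoc⇒) ∘ (braid ⊗₁ id) ∘ (assoc⇒ ⊗₁ id)       ≈⟨ pentagon ⟩∘⟨refl ⟨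
    ((id ⊗₁ assoc⇒) ∘ assoc⇒ ∘ (assoc⇒ ⊗₁ id)) ∘ (braid ⊗₁ id) ∘ (assoc⇒ ⊗₁ id)
      ≈⟨ ≈.trans assoc (refl⟩∘⟨ assoc) ⟩
    (id ⊗₁ assoc⇒) ∘ assoc⇒ ∘ (assoc⇒ ⊗₁ id) ∘ (braid ⊗₁ id) ∘ (assoc⇒ ⊗₁ id)
      ≈⟨ refl⟩∘⟨ refl⟩∘⟨ ≈.trans (refl⟩∘⟨ ⊗id-∘) ⊗id-∘ ⟩
    (id ⊗₁ assoc⇒) ∘ assoc⇒ ∘ ((assoc⇒ ∘ braid ∘ assoc⇒) ⊗₁ id)
      ≈⟨ refl⟩∘⟨ refl⟩∘⟨ hexagon ⊗id-cong ⟨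
    (id ⊗₁ assoc⇒) ∘ assoc⇒ ∘ (((id ⊗₁ braid) ∘ assoc⇒ ∘ (braid ⊗₁ id)) ⊗₁ id)
      ≈⟨ refl⟩∘⟨ refl⟩∘⟨ ≈.trans (refl⟩∘⟨ ⊗id-∘) ⊗id-∘ ⟨
    (id ⊗₁ assoc⇒) ∘ assoc⇒ ∘ ((id ⊗₁ braid) ⊗₁ id) ∘ (assoc⇒ ⊗₁ id) ∘ ((braid ⊗₁ id) ⊗₁ id)
      ≈⟨ refl⟩∘⟨ extendʳ assoc-natural ⟩
    (id ⊗₁ assoc⇒) ∘ (id ⊗₁ (braid ⊗₁ id)) ∘ assoc⇒ ∘ (assoc⇒ ⊗₁ id) ∘ ((braid ⊗₁ id) ⊗₁ id)
      ≈⟨ extendʳ (≈.trans id⊗-∘ (≈.trans (id⊗-cong ≈.sym exchange-assoc) (≈.sym id⊗-∘))) ⟩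
    (id ⊗₁ exchange) ∘ (id ⊗₁ assoc⇒) ∘ assoc⇒ ∘ (assoc⇒ ⊗₁ id) ∘ ((braid ⊗₁ id) ⊗₁ id)
      ≈⟨ refl⟩∘⟨ ≈.trans (≈.trans (refl⟩∘⟨ ≈.sym assoc) (pullˡ pentagon)) assoc ⟩
    (id ⊗₁ exchange) ∘ assoc⇒ ∘ assoc⇒ ∘ ((braid ⊗₁ id) ⊗₁ id)
      ≈⟨ refl⟩∘⟨ refl⟩∘⟨ ≈.trans assoc-natural (⊗-resp-≈ ≈.refl ⊗-id ⟩∘⟨refl) ⟩
    (id ⊗₁ exchange) ∘ assoc⇒ ∘ (braid ⊗₁ id) ∘ assoc⇒       ≈⟨ refl⟩∘⟨ extendʳ (≈.sym exchange-assoc) ⟩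
    (id ⊗₁ exchange) ∘ exchange ∘ assoc⇒ ∘ assoc⇒            ≈⟨ refl⟩∘⟨ refl⟩∘⟨ pentagon ⟨
    (id ⊗₁ exchange) ∘ exchange ∘ (id ⊗₁ assoc⇒) ∘ assoc⇒ ∘ (assoc⇒ ⊗₁ id)
      ≈⟨ ≈.trans assoc (refl⟩∘⟨ assoc) ⟨
    ((id ⊗₁ exchange) ∘ exchange ∘ (id ⊗₁ assoc⇒)) ∘ assoc⇒ ∘ (assoc⇒ ⊗₁ id)  ∎)

  -- Solves `exchange-⊗ʳ` for `id ⊗₁ assoc⇒`, which is possible since `exchange` is its own inverse.
  exchange-⊗ˡ : (id ⊗₁ assoc⇒) ∘ exchange {A ⊗₀ B} {D} {E} ≈
                exchange ∘ (id ⊗₁ exchange) ∘ assoc⇒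
  exchange-⊗ˡ = split-epi exchange-involutive (begin
    ((id ⊗₁ assoc⇒) ∘ exchange) ∘ exchange                   ≈⟨ cancelʳ exchange-involutive ⟩
    id ⊗₁ assoc⇒                                             ≈⟨ cancelˡ exchange-involutive ⟨
    exchange ∘ exchange ∘ (id ⊗₁ assoc⇒)
      ≈⟨ refl⟩∘⟨ cancelˡ (≈.trans id⊗-∘ (≈.trans (id⊗-cong exchange-involutive) ⊗-id)) ⟨
    exchange ∘ (id ⊗₁ exchange) ∘ (id ⊗₁ exchange) ∘ exchange ∘ (id ⊗₁ assoc⇒)
      ≈⟨ refl⟩∘⟨ refl⟩∘⟨ exchange-⊗ʳ ⟨
    exchange ∘ (id ⊗₁ exchange) ∘ assoc⇒ ∘ exchange          ≈⟨ ≈.trans assoc (refl⟩∘⟨ assoc) ⟨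
    (exchange ∘ (id ⊗₁ exchange) ∘ assoc⇒) ∘ exchange        ∎)

-- Words in adjacent transpositions and their permutations

infixr 9 _∙_

-- Syntax without relations, so that its actions on indices and on maps are plain recursions. `keep`
-- fixes the first factor and `swap` transposes the first two.
data Word : ℕ → Set where
  idle : ∀ {n} → Word n
  _∙_  : ∀ {n} → Word n → Word n → Word n
  keep : ∀ {n} → Word n → Word (suc n)
  swap : ∀ {n} → Word (suc (suc n))

-- The order matches `shuffle (v ∙ w) = shuffle v ∘ shuffle w`: output factor `j` comes from
-- position `v j` of the intermediate tuple, hence from position `w (v j)` of the input, and `∘ₚ`
-- applies its left argument first.
toPermutation : ∀ {n} → Word n → Permutation′ n
toPermutation idle     = Perm.id
toPermutation (v ∙ w)  = toPermutation v ∘ₚ toPermutation w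
toPermutation (keep w) = lift₀ (toPermutation w)
toPermutation swap     = Perm.swap Perm.id

-- Follows the clauses of `extract`, as `fromPermutation` follows those of `permute`; the resulting
-- maps are then propositionally equal, not just related by `≈`.
extractWord : ∀ {n} → Fin (suc n) → Word (suc n)
extractWord         zero    = idle
extractWord {suc n} (suc i) = swap ∙ keep (extractWord i)

fromPermutation : ∀ {n} → Permutation′ n → Word n
fromPermutation {zero}  σ = idle
fromPermutation {suc n} σ = keep (fromPermutation (remove zero σ)) ∙ extractWord (σ ⟨$⟩ʳ zero)

-- The part of the rearrangement that is left when the i-th factor of the output
-- is dropped, together with the input factor it came from.
delete : ∀ {n} → Word (suc n) → Fin (suc n) → Word n
delete idle             i             = idle
delete (v ∙ w)          i             = delete v i ∙ delete w (toPermutation v ⟨$⟩ʳ i)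
delete (keep w)         zero          = w
delete {suc n} (keep w) (suc i)       = keep (delete w i)
delete swap             zero          = idle
delete swap             (suc zero)    = idle
delete {suc (suc n)} swap (suc (suc i)) = swap

-- The counterpart of `punchIn-permute`: `delete` does to words what `remove` does to permutations.
punchIn-delete : ∀ {n} (w : Word (suc n)) i j →
  punchIn (toPermutation w ⟨$⟩ʳ i) (toPermutation (delete w i) ⟨$⟩ʳ j) ≡
  toPermutation w ⟨$⟩ʳ punchIn i j
punchIn-delete idle             i       j       = refl
punchIn-delete (v ∙ w)          i       j       = ≡.trans
  (punchIn-delete w (toPermutation v ⟨$⟩ʳ i) (toPermutation (delete v i) ⟨$⟩ʳ j))
  (cong (toPermutation w ⟨$⟩ʳ_) (punchIn-delete v i j))
punchIn-delete (keep w)         zero    j       = refl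
punchIn-delete {suc n} (keep w) (suc i) zero    = refl
punchIn-delete {suc n} (keep w) (suc i) (suc j) = cong suc (punchIn-delete w i j)
punchIn-delete swap             zero       zero    = refl
punchIn-delete swap             zero       (suc j) = refl
punchIn-delete swap             (suc zero) zero    = refl
punchIn-delete swap             (suc zero) (suc j) = refl
punchIn-delete {suc (suc n)} swap (suc (suc i)) zero          = refl
punchIn-delete {suc (suc n)} swap (suc (suc i)) (suc zero)    = refl
punchIn-delete {suc (suc n)} swap (suc (suc i)) (suc (suc j)) = refl

remove-∘ₚ : ∀ {n} (σ : Permutation′ (suc n)) (w : Word (suc n)) →
  remove zero σ ∘ₚ toPermutation (delete w (σ ⟨$⟩ʳ zero)) Perm.≈
  remove zero (σ ∘ₚ toPermutation w)
remove-∘ₚ σ w j = punchIn-injective (toPermutation w ⟨$⟩ʳ (σ ⟨$⟩ʳ zero)) _ _ (begin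
  punchIn (ρ ⟨$⟩ʳ (σ ⟨$⟩ʳ zero)) (toPermutation (delete w (σ ⟨$⟩ʳ zero)) ⟨$⟩ʳ (remove zero σ ⟨$⟩ʳ j))
    ≡⟨ punchIn-delete w (σ ⟨$⟩ʳ zero) (remove zero σ ⟨$⟩ʳ j) ⟩
  ρ ⟨$⟩ʳ punchIn (σ ⟨$⟩ʳ zero) (remove zero σ ⟨$⟩ʳ j)
    ≡⟨ cong (ρ ⟨$⟩ʳ_) (punchIn-permute σ zero j) ⟨
  ρ ⟨$⟩ʳ (σ ⟨$⟩ʳ suc j)
    ≡⟨ punchIn-permute (σ ∘ₚ ρ) zero j ⟩
  punchIn (ρ ⟨$⟩ʳ (σ ⟨$⟩ʳ zero)) (remove zero (σ ∘ₚ ρ) ⟨$⟩ʳ j) ∎)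
  where
  open ≡.≡-Reasoning
  ρ = toPermutation w

remove-id : ∀ {n} → remove zero (Perm.id {suc n}) Perm.≈ Perm.id
remove-id j = suc-injective (≡.sym (punchIn-permute Perm.id zero j))

index : ∀ {n} → Permutation′ n → Fin (n !)
index {n} σ = proj₁ (enumerate-surjective n σ)

enumerate-index : ∀ {n} (σ : Permutation′ n) → enumerate n (index σ) Perm.≈ σ
enumerate-index {n} σ = proj₂ (enumerate-surjective n σ)

-- The translation `σ ↦ σ ∘ₚ ρ` of the symmetric group, carried over to indices by `enumerate`. The
-- invariance of `u` is stated for permutations of `Fin (n !)`, hence this form.
precompose : ∀ {n} → Permutation′ n → Permutation′ (n !)
precompose {n} ρ = permutation (act ρ) (act (flip ρ))
  (act-cancel (flip ρ) ρ (λ _ → inverseʳ ρ)) (act-cancel ρ (flip ρ) (λ _ → inverseˡ ρ))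
  where
  act : Permutation′ n → Fin (n !) → Fin (n !)
  act ρ k = index (enumerate n k ∘ₚ ρ)

  act-cancel : ∀ ρ ρ′ → (∀ i → ρ′ ⟨$⟩ʳ (ρ ⟨$⟩ʳ i) ≡ i) → ∀ k → act ρ′ (act ρ k) ≡ k
  act-cancel ρ ρ′ inv k = enumerate-injective n _ _ λ i → ≡.trans
    (enumerate-index (enumerate n (act ρ k) ∘ₚ ρ′) i)
    (≡.trans (cong (ρ′ ⟨$⟩ʳ_) (enumerate-index (enumerate n k ∘ₚ ρ) i)) (inv _))

-- Words acting on tensor powers

module Shuffles {o ℓ e} (𝐂 : UniformMarkovCategory o ℓ e) where
  open UniformMarkovCategory 𝐂
  open Multisets 𝐂
  open Composition category
  open Coherence symmetricMonoidal

  private variable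
    A B X Z : Obj
    n : ℕ

  -- Naturality of `exchange` in its middle argument, applied to `braid`, with the passage of the
  -- product expanded by `exchange-⊗ʳ` on either side.
  yang-baxter : ∀ {A B D E} →
    exchange ∘ (id ⊗₁ exchange) ∘ exchange {A} {B} {D ⊗₀ E} ≈
    (id ⊗₁ exchange) ∘ exchange ∘ (id ⊗₁ exchange)
  yang-baxter = split-epi (≈.trans id⊗-∘ (≈.trans (id⊗-cong assoc-isoʳ) ⊗-id)) (begin
    (exchange ∘ (id ⊗₁ exchange) ∘ exchange) ∘ (id ⊗₁ assoc⇒)     ≈⟨ ≈.trans assoc (refl⟩∘⟨ assoc) ⟩
    exchange ∘ (id ⊗₁ exchange) ∘ exchange ∘ (id ⊗₁ assoc⇒)       ≈⟨ refl⟩∘⟨ exchange-⊗ʳ ⟨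
    exchange ∘ assoc⇒ ∘ exchange                                 ≈⟨ extendʳ exchange-assoc ⟩
    assoc⇒ ∘ (braid ⊗₁ id) ∘ exchange
      ≈⟨ refl⟩∘⟨ ⊗-resp-≈ ≈.refl ⊗-id ⟩∘⟨refl ⟨
    assoc⇒ ∘ (braid ⊗₁ (id ⊗₁ id)) ∘ exchange                    ≈⟨ refl⟩∘⟨ exchange-natural ⟨
    assoc⇒ ∘ exchange ∘ (id ⊗₁ (braid ⊗₁ id))                    ≈⟨ pullˡ exchange-⊗ʳ ⟩
    ((id ⊗₁ exchange) ∘ exchange ∘ (id ⊗₁ assoc⇒)) ∘ (id ⊗₁ (braid ⊗₁ id))
      ≈⟨ ≈.trans assoc (refl⟩∘⟨ assoc) ⟩
    (id ⊗₁ exchange) ∘ exchange ∘ (id ⊗₁ assoc⇒) ∘ (id ⊗₁ (braid ⊗₁ id))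
      ≈⟨ refl⟩∘⟨ refl⟩∘⟨ ≈.trans id⊗-∘ (≈.trans (id⊗-cong ≈.sym exchange-assoc) (≈.sym id⊗-∘)) ⟩
    (id ⊗₁ exchange) ∘ exchange ∘ (id ⊗₁ exchange) ∘ (id ⊗₁ assoc⇒)
      ≈⟨ ≈.trans assoc (refl⟩∘⟨ assoc) ⟨
    ((id ⊗₁ exchange) ∘ exchange ∘ (id ⊗₁ exchange)) ∘ (id ⊗₁ assoc⇒) ∎)

  shuffle : Word n → X ^ n ⇒ X ^ n
  shuffle idle     = id
  shuffle (v ∙ w)  = shuffle v ∘ shuffle w
  shuffle (keep w) = id ⊗₁ shuffle w
  shuffle swap     = exchange

  shuffle-extractWord : (i : Fin (suc n)) → shuffle {X = X} (extractWord i) ≡ extract i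
  shuffle-extractWord         zero    = refl
  shuffle-extractWord {suc n} (suc i) = cong (λ f → exchange ∘ (id ⊗₁ f)) (shuffle-extractWord i)

  shuffle-fromPermutation : (σ : Permutation′ n) → shuffle {X = X} (fromPermutation σ) ≡ permute σ
  shuffle-fromPermutation {zero}  σ = refl
  shuffle-fromPermutation {suc n} σ = ≡.cong₂ (λ f g → (id ⊗₁ f) ∘ g)
    (shuffle-fromPermutation (remove zero σ)) (shuffle-extractWord (σ ⟨$⟩ʳ zero))

  -- Extraction commutes with each generator, at the cost of tracking the index and deleting the
  -- extracted factor from the word.
  extract-shuffle : (w : Word (suc n)) (i : Fin (suc n)) →
    extract i ∘ shuffle {X = X} w ≈ (id ⊗₁ shuffle (delete w i)) ∘ extract (toPermutation w ⟨$⟩ʳ i)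
  extract-shuffle idle i = begin
    extract i ∘ id            ≈⟨ identityʳ ⟩
    extract i                 ≈⟨ identityˡ ⟨
    id ∘ extract i            ≈⟨ ⊗-id ⟩∘⟨refl ⟨
    (id ⊗₁ id) ∘ extract i    ∎
  extract-shuffle (v ∙ w) i = ≈.trans (extendʳ (extract-shuffle v i))
    (≈.trans (refl⟩∘⟨ extract-shuffle w (toPermutation v ⟨$⟩ʳ i)) (pullˡ id⊗-∘))
  extract-shuffle (keep w) zero = ≈.trans identityˡ (≈.sym identityʳ)
  extract-shuffle {suc n} (keep w) (suc i) = begin
    (exchange ∘ (id ⊗₁ extract i)) ∘ (id ⊗₁ shuffle w)
      ≈⟨ pullʳ (≈.trans id⊗-∘ (≈.trans (id⊗-cong extract-shuffle w i) (≈.sym id⊗-∘))) ⟩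
    exchange ∘ (id ⊗₁ (id ⊗₁ shuffle (delete w i))) ∘ (id ⊗₁ extract (toPermutation w ⟨$⟩ʳ i))
      ≈⟨ extendʳ exchange-natural ⟩
    (id ⊗₁ (id ⊗₁ shuffle (delete w i))) ∘ exchange ∘ (id ⊗₁ extract (toPermutation w ⟨$⟩ʳ i)) ∎
  extract-shuffle swap zero = begin
    id ∘ exchange                               ≈⟨ identityˡ ⟩
    exchange                                    ≈⟨ identityʳ ⟨
    exchange ∘ id                               ≈⟨ refl⟩∘⟨ ⊗-id ⟨
    exchange ∘ (id ⊗₁ id)                       ≈⟨ identityˡ ⟨
    id ∘ exchange ∘ (id ⊗₁ id)                  ≈⟨ ⊗-id ⟩∘⟨refl ⟨
    (id ⊗₁ id) ∘ exchange ∘ (id ⊗₁ id)          ∎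
  extract-shuffle swap (suc zero) = begin
    (exchange ∘ (id ⊗₁ id)) ∘ exchange          ≈⟨ ≈.trans (refl⟩∘⟨ ⊗-id) identityʳ ⟩∘⟨refl ⟩
    exchange ∘ exchange                         ≈⟨ exchange-involutive ⟩
    id                                          ≈⟨ ≈.trans identityʳ ⊗-id ⟨
    (id ⊗₁ id) ∘ id                             ∎
  -- The extracted factor crosses both swapped factors, which is where Yang-Baxter enters.
  extract-shuffle {suc (suc n)} swap (suc (suc i)) = begin
    (exchange ∘ (id ⊗₁ (exchange ∘ (id ⊗₁ extract i)))) ∘ exchange
      ≈⟨ (refl⟩∘⟨ ≈.sym id⊗-∘) ⟩∘⟨refl ⟩
    (exchange ∘ (id ⊗₁ exchange) ∘ (id ⊗₁ (id ⊗₁ extract i))) ∘ exchange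
      ≈⟨ ≈.trans assoc (refl⟩∘⟨ assoc) ⟩
    exchange ∘ (id ⊗₁ exchange) ∘ (id ⊗₁ (id ⊗₁ extract i)) ∘ exchange
      ≈⟨ refl⟩∘⟨ refl⟩∘⟨ exchange-natural ⟨
    exchange ∘ (id ⊗₁ exchange) ∘ exchange ∘ (id ⊗₁ (id ⊗₁ extract i))
      ≈⟨ ≈.trans (refl⟩∘⟨ ≈.sym assoc) (≈.trans (pullˡ yang-baxter) (≈.trans assoc (refl⟩∘⟨ assoc))) ⟩
    (id ⊗₁ exchange) ∘ exchange ∘ (id ⊗₁ exchange) ∘ (id ⊗₁ (id ⊗₁ extract i))
      ≈⟨ refl⟩∘⟨ refl⟩∘⟨ id⊗-∘ ⟩
    (id ⊗₁ exchange) ∘ exchange ∘ (id ⊗₁ (exchange ∘ (id ⊗₁ extract i))) ∎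

  -- The recursion of `permute` peels off the first output, and `extract-shuffle` carries this
  -- peeling through the word. Words on the right suffice, as `acc` and `perm` are only ever
  -- precomposed with them.
  permute-shuffle : (σ : Permutation′ n) (w : Word n) →
    permute σ ∘ shuffle {X = X} w ≈ permute (σ ∘ₚ toPermutation w)
  permute-shuffle {zero}  σ w = discard-unique
  permute-shuffle {suc n} σ w = begin
    ((id ⊗₁ permute (remove zero σ)) ∘ extract (σ ⟨$⟩ʳ zero)) ∘ shuffle w
      ≈⟨ pullʳ (extract-shuffle w (σ ⟨$⟩ʳ zero)) ⟩
    (id ⊗₁ permute (remove zero σ)) ∘ (id ⊗₁ shuffle w′) ∘ extract (toPermutation w ⟨$⟩ʳ (σ ⟨$⟩ʳ zero))
      ≈⟨ pullˡ id⊗-∘ ⟩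
    (id ⊗₁ (permute (remove zero σ) ∘ shuffle w′)) ∘ extract (toPermutation w ⟨$⟩ʳ (σ ⟨$⟩ʳ zero))
      ≈⟨ (id⊗-cong ≈.trans (permute-shuffle (remove zero σ) w′)
            (permute-cong {σ = remove zero σ ∘ₚ toPermutation w′} {remove zero (σ ∘ₚ toPermutation w)}
              (remove-∘ₚ σ w))) ⟩∘⟨refl ⟩
    permute (σ ∘ₚ toPermutation w) ∎
    where w′ = delete w (σ ⟨$⟩ʳ zero)

  permute-id : ∀ K → permute {K} {X} Perm.id ≈ id
  permute-id zero    = ≈.refl
  permute-id (suc K) = begin
    (id ⊗₁ permute {K} (remove zero Perm.id)) ∘ id  ≈⟨ identityʳ ⟩
    id ⊗₁ permute {K} (remove zero Perm.id)
      ≈⟨ id⊗-cong ≈.trans (permute-cong {K} {σ = remove zero Perm.id} {Perm.id} remove-id) (permute-id K) ⟩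
    id ⊗₁ id                                        ≈⟨ ⊗-id ⟩
    id                                              ∎

  shuffle-permute : ∀ K (w : Word K) → shuffle {X = X} w ≈ permute (toPermutation w)
  shuffle-permute K w = begin
    shuffle w                                 ≈⟨ identityˡ ⟨
    id ∘ shuffle w                            ≈⟨ permute-id K ⟩∘⟨refl ⟨
    permute {K} Perm.id ∘ shuffle w           ≈⟨ permute-shuffle Perm.id w ⟩
    permute {K} (Perm.id ∘ₚ toPermutation w)  ≈⟨ permute-cong {σ = Perm.id ∘ₚ toPermutation w} {toPermutation w} (λ _ → refl) ⟩
    permute (toPermutation w)                 ∎

  acc-permute : ∀ K (σ : Permutation′ K) → acc K {X} ∘ permute σ ≈ acc K
  acc-permute {X} K σ = begin
    acc K ∘ permute {K} σ        ≈⟨ IsCoequaliser.equalises (acc-isCoequaliser K X) σ Perm.id ⟩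
    acc K ∘ permute {K} Perm.id  ≈⟨ refl⟩∘⟨ permute-id K ⟩
    acc K ∘ id                   ≈⟨ identityʳ ⟩
    acc K                        ∎

  acc-shuffle : ∀ K (w : Word K) → acc K {X} ∘ shuffle w ≈ acc K
  acc-shuffle K w = ≈.trans (refl⟩∘⟨ shuffle-permute K w) (acc-permute K (toPermutation w))

  -- Convex sums and averages over permutations

  ∐-ext : ∀ {n} {A : Fin n → Obj} {h k : ∐ A ⇒ Z} → (∀ i → h ∘ ι i ≈ k ∘ ι i) → h ≈ k
  ∐-ext {A = A} = Colimit.unique (colimit (discrete category A))

  []-ι : ∀ {n} {A : Fin n → Obj} (f : ∀ i → A i ⇒ Z) i → [ f ] ∘ ι i ≈ f i
  []-ι {A = A} f =
    Colimit.mediate-leg (colimit (discrete category A)) (record { leg = f ; commute = λ () })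

  -- By distributivity the maps `id ⊗₁ ι i` are jointly epic, so that convex sums can be compared
  -- one index at a time.
  ⊗∐-ext : ∀ {n} {B : Fin n → Obj} {h k : A ⊗₀ ∐ B ⇒ Z} →
           (∀ i → h ∘ (id ⊗₁ ι i) ≈ k ∘ (id ⊗₁ ι i)) → h ≈ k
  ⊗∐-ext {B = B} eq = split-epi (IsIso.isoʳ (distribute-isIso {B = B})) (∐-ext λ i →
    ≈.trans (pullʳ ([]-ι _ i)) (≈.trans (eq i) (≈.sym (pullʳ ([]-ι _ i)))))

  -- The part of a convex sum that does not depend on the state.
  cases : (Fin n → A ⇒ B) → A ⊗₀ ⟦ n ⟧ ⇒ B
  cases f = [ (λ i → f i ∘ unitʳ⇒) ] ∘ undistribute

  cases-ι : (f : Fin n → A ⇒ B) (i : Fin n) → cases f ∘ (id ⊗₁ ι i) ≈ f i ∘ unitʳ⇒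
  cases-ι f i = begin
    ([ (λ i → f i ∘ unitʳ⇒) ] ∘ undistribute) ∘ (id ⊗₁ ι i)
      ≈⟨ pullʳ (refl⟩∘⟨ ≈.sym ([]-ι _ i)) ⟩
    [ (λ i → f i ∘ unitʳ⇒) ] ∘ undistribute ∘ distribute ∘ ι i
      ≈⟨ refl⟩∘⟨ cancelˡ (IsIso.isoˡ distribute-isIso) ⟩
    [ (λ i → f i ∘ unitʳ⇒) ] ∘ ι i  ≈⟨ []-ι _ i ⟩
    f i ∘ unitʳ⇒                    ∎

  convexSum-cases : (r : unit ⇒ ⟦ n ⟧) (f : Fin n → A ⇒ B) →
    convexSum r f ≈ cases f ∘ (id ⊗₁ r) ∘ unitʳ⇐
  convexSum-cases r f = ≈.sym assoc

  ∘-convexSum : (r : unit ⇒ ⟦ n ⟧) (f : Fin n → A ⇒ B) (h : B ⇒ Z) →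
    h ∘ convexSum r f ≈ convexSum r (λ i → h ∘ f i)
  ∘-convexSum r f h = begin
    h ∘ convexSum r f                          ≈⟨ refl⟩∘⟨ convexSum-cases r f ⟩
    h ∘ cases f ∘ (id ⊗₁ r) ∘ unitʳ⇐
      ≈⟨ pullˡ (⊗∐-ext λ i → ≈.trans (pullʳ (cases-ι f i)) (≈.trans (≈.sym assoc) (≈.sym (cases-ι _ i)))) ⟩
    cases (λ i → h ∘ f i) ∘ (id ⊗₁ r) ∘ unitʳ⇐  ≈⟨ convexSum-cases r _ ⟨
    convexSum r (λ i → h ∘ f i)                ∎

  convexSum-∘ : (r : unit ⇒ ⟦ n ⟧) (f : Fin n → A ⇒ B) (g : Z ⇒ A) →
    convexSum r f ∘ g ≈ convexSum r (λ i → f i ∘ g)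
  convexSum-∘ r f g = begin
    convexSum r f ∘ g                          ≈⟨ convexSum-cases r f ⟩∘⟨refl ⟩
    (cases f ∘ (id ⊗₁ r) ∘ unitʳ⇐) ∘ g         ≈⟨ pullʳ (pullʳ unitʳ⇐-natural) ⟩
    cases f ∘ (id ⊗₁ r) ∘ (g ⊗₁ id) ∘ unitʳ⇐   ≈⟨ refl⟩∘⟨ extendʳ (≈.sym ⊗-slide) ⟩
    cases f ∘ (g ⊗₁ id) ∘ (id ⊗₁ r) ∘ unitʳ⇐   ≈⟨ pullˡ (⊗∐-ext step) ⟩
    cases (λ i → f i ∘ g) ∘ (id ⊗₁ r) ∘ unitʳ⇐  ≈⟨ convexSum-cases r _ ⟨
    convexSum r (λ i → f i ∘ g)                ∎
    where
    step : ∀ i → (cases f ∘ (g ⊗₁ id)) ∘ (id ⊗₁ ι i) ≈ cases (λ i → f i ∘ g) ∘ (id ⊗₁ ι i)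
    step i = begin
      (cases f ∘ (g ⊗₁ id)) ∘ (id ⊗₁ ι i)     ≈⟨ pullʳ ⊗-slide ⟩
      cases f ∘ (id ⊗₁ ι i) ∘ (g ⊗₁ id)       ≈⟨ extendʳ (cases-ι f i) ⟩
      f i ∘ unitʳ⇒ ∘ (g ⊗₁ id)                ≈⟨ refl⟩∘⟨ unitʳ-natural ⟩
      f i ∘ g ∘ unitʳ⇒                        ≈⟨ assoc ⟨
      (f i ∘ g) ∘ unitʳ⇒                      ≈⟨ cases-ι _ i ⟨
      cases (λ i → f i ∘ g) ∘ (id ⊗₁ ι i)     ∎

  convexSum-cong : (r : unit ⇒ ⟦ n ⟧) {f g : Fin n → A ⇒ B} → (∀ i → f i ≈ g i) →
    convexSum r f ≈ convexSum r g
  convexSum-cong r eq = ∐-ext (λ i → ≈.trans ([]-ι _ i)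
    (≈.trans (eq i ⟩∘⟨refl) (≈.sym ([]-ι _ i)))) ⟩∘⟨refl

  -- The index no longer matters and can be discarded; `discard ∘ r` is the identity because the
  -- unit is final. This is the normalisation of the weights.
  convexSum-const : (r : unit ⇒ ⟦ n ⟧) (f : A ⇒ B) → convexSum r (λ _ → f) ≈ f
  convexSum-const r f = begin
    convexSum r (λ _ → f)                           ≈⟨ convexSum-cases r _ ⟩
    cases (λ _ → f) ∘ (id ⊗₁ r) ∘ unitʳ⇐             ≈⟨ ⊗∐-ext step ⟩∘⟨refl ⟩
    (f ∘ unitʳ⇒ ∘ (id ⊗₁ discard)) ∘ (id ⊗₁ r) ∘ unitʳ⇐  ≈⟨ ≈.trans assoc (refl⟩∘⟨ assoc) ⟩
    f ∘ unitʳ⇒ ∘ (id ⊗₁ discard) ∘ (id ⊗₁ r) ∘ unitʳ⇐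
      ≈⟨ refl⟩∘⟨ refl⟩∘⟨ cancelˡ (≈.trans id⊗-∘ (≈.trans (id⊗-cong discard-unique) ⊗-id)) ⟩
    f ∘ unitʳ⇒ ∘ unitʳ⇐                              ≈⟨ ≈.trans (refl⟩∘⟨ unitʳ-isoʳ) identityʳ ⟩
    f                                               ∎
    where
    step : ∀ i → cases (λ _ → f) ∘ (id ⊗₁ ι i) ≈ (f ∘ unitʳ⇒ ∘ (id ⊗₁ discard)) ∘ (id ⊗₁ ι i)
    step i = begin
      cases (λ _ → f) ∘ (id ⊗₁ ι i)                  ≈⟨ cases-ι _ i ⟩
      f ∘ unitʳ⇒                                    ≈⟨ refl⟩∘⟨ ≈.trans (refl⟩∘⟨
                                                         ≈.trans id⊗-∘ (≈.trans (id⊗-cong discard-unique) ⊗-id)) identityʳ ⟨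
      f ∘ unitʳ⇒ ∘ (id ⊗₁ discard) ∘ (id ⊗₁ ι i)      ≈⟨ ≈.trans assoc (refl⟩∘⟨ assoc) ⟨
      (f ∘ unitʳ⇒ ∘ (id ⊗₁ discard)) ∘ (id ⊗₁ ι i)    ∎

  convexSum-reindex : (r : unit ⇒ ⟦ n ⟧) (f : Fin n → A ⇒ B) (π : Permutation′ n) →
    convexSum r (λ i → f (π ⟨$⟩ʳ i)) ≈ convexSum (⟦ π ⟧ₚ ∘ r) f
  convexSum-reindex r f π = begin
    convexSum r (λ i → f (π ⟨$⟩ʳ i))                    ≈⟨ convexSum-cases r _ ⟩
    cases (λ i → f (π ⟨$⟩ʳ i)) ∘ (id ⊗₁ r) ∘ unitʳ⇐       ≈⟨ ⊗∐-ext step ⟩∘⟨refl ⟩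
    (cases f ∘ (id ⊗₁ ⟦ π ⟧ₚ)) ∘ (id ⊗₁ r) ∘ unitʳ⇐       ≈⟨ pullʳ (pullˡ id⊗-∘) ⟩
    cases f ∘ (id ⊗₁ (⟦ π ⟧ₚ ∘ r)) ∘ unitʳ⇐              ≈⟨ convexSum-cases _ f ⟨
    convexSum (⟦ π ⟧ₚ ∘ r) f                            ∎
    where
    step : ∀ i → cases (λ i → f (π ⟨$⟩ʳ i)) ∘ (id ⊗₁ ι i) ≈ (cases f ∘ (id ⊗₁ ⟦ π ⟧ₚ)) ∘ (id ⊗₁ ι i)
    step i = ≈.trans (cases-ι _ i) (≈.sym (≈.trans
      (pullʳ (≈.trans id⊗-∘ (id⊗-cong []-ι _ i))) (cases-ι f (π ⟨$⟩ʳ i))))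

  convexSum-resp-≈ : {r s : unit ⇒ ⟦ n ⟧} (f : Fin n → A ⇒ B) → r ≈ s → convexSum r f ≈ convexSum s f
  convexSum-resp-≈ f eq = refl⟩∘⟨ refl⟩∘⟨ (id⊗-cong eq) ⟩∘⟨refl

  acc-perm : ∀ K → acc K {X} ∘ perm K ≈ acc K
  acc-perm K = begin
    acc K ∘ perm K                                           ≈⟨ ∘-convexSum _ _ _ ⟩
    convexSum _ (λ k → acc K ∘ permute (enumerate K k))      ≈⟨ convexSum-cong _ (λ k → acc-permute K (enumerate K k)) ⟩
    convexSum _ (λ _ → acc K)                                ≈⟨ convexSum-const _ _ ⟩
    acc K                                                    ∎

  -- Composition with a word only permutes the summands, by `precompose`, and `u-permute` makes the
  -- weights insensitive to that. The existence of `arr` rests on this.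
  perm-shuffle : ∀ K (w : Word K) → perm K {X} ∘ shuffle w ≈ perm K
  perm-shuffle {X} K w = begin
    perm K ∘ shuffle w                                       ≈⟨ convexSum-∘ _ _ _ ⟩
    convexSum (u (K !) {{K !≢0}}) (λ k → permute (enumerate K k) ∘ shuffle w)
      ≈⟨ convexSum-cong _ reindex ⟩
    convexSum (u (K !) {{K !≢0}}) (λ k → permute (enumerate K (π ⟨$⟩ʳ k)))
      ≈⟨ convexSum-reindex _ (λ k → permute (enumerate K k)) π ⟩
    convexSum (⟦ π ⟧ₚ ∘ u (K !) {{K !≢0}}) (λ k → permute (enumerate K k))
      ≈⟨ convexSum-resp-≈ _ (u-permute (K !) {{K !≢0}} π) ⟩
    perm K                                                   ∎
    where
    π = precompose (toPermutation w)
    reindex : ∀ k → permute {X = X} (enumerate K k) ∘ shuffle w ≈ permute (enumerate K (π ⟨$⟩ʳ k))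
    reindex k = ≈.trans (permute-shuffle (enumerate K k) w)
      (permute-cong {σ = enumerate K k ∘ₚ toPermutation w} {enumerate K (π ⟨$⟩ʳ k)}
        (λ i → ≡.sym (enumerate-index (enumerate K k ∘ₚ toPermutation w) i)))

  perm-permute : ∀ K (σ : Permutation′ K) → perm K {X} ∘ permute σ ≈ perm K
  perm-permute K σ = ≈.trans (refl⟩∘⟨ ≈.reflexive (≡.sym (shuffle-fromPermutation σ)))
    (perm-shuffle K (fromPermutation σ))

  arrangement : Arrangement
  arrangement = record
    { arr     = λ K {X} → IsCoequaliser.mediate (acc-isCoequaliser K X) (perm K) equal
    ; arr-acc = λ K {X} → IsCoequaliser.mediate-∘ (acc-isCoequaliser K X) (perm K) equal
    }
    where
    equal : ∀ {K X} (σ τ : Permutation′ K) → perm K {X} ∘ permute σ ≈ perm K ∘ permute τ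
    equal {K} σ τ = ≈.trans (perm-permute K σ) (≈.sym (perm-permute K τ))

-- Closure properties of deterministic maps

module Determinism {o ℓ e} (𝐂 : UniformMarkovCategory o ℓ e) where
  open UniformMarkovCategory 𝐂
  open Multisets 𝐂
  open Composition category
  open Coherence symmetricMonoidal

  private variable
    A B D A′ B′ D′ A″ B″ : Obj

  interchange-natural : {f : A ⇒ A′} {g : B ⇒ B′} {h : D ⇒ D′} {k : A″ ⇒ B″} →
    ((f ⊗₁ g) ⊗₁ (h ⊗₁ k)) ∘ interchange ≈ interchange ∘ ((f ⊗₁ h) ⊗₁ (g ⊗₁ k))
  interchange-natural {f = f} {g = g} {h = h} {k = k} = split-mono assoc-isoˡ (begin
    assoc⇒ ∘ ((f ⊗₁ g) ⊗₁ (h ⊗₁ k)) ∘ interchange       ≈⟨ extendʳ assoc-natural ⟩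
    (f ⊗₁ (g ⊗₁ (h ⊗₁ k))) ∘ assoc⇒ ∘ interchange       ≈⟨ refl⟩∘⟨ cancelˡ assoc-isoʳ ⟩
    (f ⊗₁ (g ⊗₁ (h ⊗₁ k))) ∘ (id ⊗₁ exchange) ∘ assoc⇒
      ≈⟨ extendʳ (≈.trans (≈.sym ⊗-∘) (≈.trans
           (⊗-resp-≈ (≈.trans identityʳ (≈.sym identityˡ)) (≈.sym exchange-natural)) ⊗-∘)) ⟩
    (id ⊗₁ exchange) ∘ (f ⊗₁ (h ⊗₁ (g ⊗₁ k))) ∘ assoc⇒  ≈⟨ refl⟩∘⟨ assoc-natural ⟨
    (id ⊗₁ exchange) ∘ assoc⇒ ∘ ((f ⊗₁ h) ⊗₁ (g ⊗₁ k))  ≈⟨ cancelˡ assoc-isoʳ ⟨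
    assoc⇒ ∘ assoc⇐ ∘ (id ⊗₁ exchange) ∘ assoc⇒ ∘ ((f ⊗₁ h) ⊗₁ (g ⊗₁ k))
      ≈⟨ refl⟩∘⟨ ≈.trans assoc (refl⟩∘⟨ assoc) ⟨
    assoc⇒ ∘ interchange ∘ ((f ⊗₁ h) ⊗₁ (g ⊗₁ k))       ∎)

  id-det : Deterministic (id {A})
  id-det = ≈.trans (≈.trans (⊗-id ⟩∘⟨refl) identityˡ) (≈.sym identityʳ)

  ∘-det : (g : B ⇒ D) (f : A ⇒ B) → Deterministic g → Deterministic f → Deterministic (g ∘ f)
  ∘-det g f dg df = begin
    ((g ∘ f) ⊗₁ (g ∘ f)) ∘ δ      ≈⟨ pushˡ ⊗-∘ ⟩
    (g ⊗₁ g) ∘ (f ⊗₁ f) ∘ δ       ≈⟨ refl⟩∘⟨ df ⟩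
    (g ⊗₁ g) ∘ δ ∘ f              ≈⟨ extendʳ dg ⟩
    δ ∘ g ∘ f                     ∎

  ⊗-det : (f : A ⇒ A′) (g : B ⇒ B′) → Deterministic f → Deterministic g → Deterministic (f ⊗₁ g)
  ⊗-det f g df dg = begin
    ((f ⊗₁ g) ⊗₁ (f ⊗₁ g)) ∘ δ                      ≈⟨ refl⟩∘⟨ δ-⊗ ⟩
    ((f ⊗₁ g) ⊗₁ (f ⊗₁ g)) ∘ interchange ∘ (δ ⊗₁ δ)  ≈⟨ extendʳ interchange-natural ⟩
    interchange ∘ ((f ⊗₁ f) ⊗₁ (g ⊗₁ g)) ∘ (δ ⊗₁ δ)
      ≈⟨ refl⟩∘⟨ ≈.trans (≈.sym ⊗-∘) (≈.trans (⊗-resp-≈ df dg) ⊗-∘) ⟩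
    interchange ∘ (δ ⊗₁ δ) ∘ (f ⊗₁ g)               ≈⟨ pullˡ (≈.sym δ-⊗) ⟩
    δ ∘ (f ⊗₁ g)                                    ∎

  -- Both sides of the claim agree after `q`, which can be cancelled. The section `s` is not assumed
  -- deterministic; this matters since `arr` averages over permutations.
  split-epi-det : (h : B ⇒ D) (q : A ⇒ B) {s : B ⇒ A} → q ∘ s ≈ id →
    Deterministic q → Deterministic (h ∘ q) → Deterministic h
  split-epi-det h q split dq dhq = split-epi split (begin
    ((h ⊗₁ h) ∘ δ) ∘ q            ≈⟨ pullʳ (≈.sym dq) ⟩
    (h ⊗₁ h) ∘ (q ⊗₁ q) ∘ δ       ≈⟨ pullˡ (≈.sym ⊗-∘) ⟩
    ((h ∘ q) ⊗₁ (h ∘ q)) ∘ δ      ≈⟨ dhq ⟩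
    δ ∘ h ∘ q                     ≈⟨ assoc ⟨
    (δ ∘ h) ∘ q                   ∎)

  resp-det : {f g : A ⇒ B} → f ≈ g → Deterministic f → Deterministic g
  resp-det eq df = ≈.trans (⊗-resp-≈ (≈.sym eq) (≈.sym eq) ⟩∘⟨refl) (≈.trans df (refl⟩∘⟨ eq))

  assoc⇐-det : Deterministic (assoc⇐ {A} {B} {D})
  assoc⇐-det = split-epi-det assoc⇐ assoc⇒ assoc-isoʳ assoc-det (resp-det (≈.sym assoc-isoˡ) id-det)

  exchange-det : Deterministic (exchange {A} {B} {D})
  exchange-det = ∘-det _ _ assoc-det (∘-det _ _ (⊗-det _ _ braid-det id-det) assoc⇐-det)

-- Concatenation of tuples up to reordering

module Concatenation {o ℓ e} (𝐂 : UniformMarkovCategory o ℓ e) where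
  open UniformMarkovCategory 𝐂
  open Multisets 𝐂
  open Composition category
  open Coherence symmetricMonoidal
  open Shuffles 𝐂

  private variable
    A B D X Z : Obj
    l m n : ℕ

  infix 3 _∣_∣_⊢_∼_

  -- f and g agree up to a permutation of the factors and an equality of their
  -- numbers; X, m and n are explicit because X ^ m does not determine them.
  record _∣_∣_⊢_∼_ (X : Obj) (m n : ℕ) (f : A ⇒ X ^ m) (g : A ⇒ X ^ n) : Set e where
    constructor shuffled
    field
      size : n ≡ m
      word : Word m
      eq   : f ≈ shuffle word ∘ coerce category (λ k Y → Y ^ k) {A = X} size ∘ g

  ≈⇒∼ : {f f′ : A ⇒ X ^ m} → f ≈ f′ → X ∣ m ∣ m ⊢ f ∼ f′
  ≈⇒∼ eq = shuffled refl idle (≈.trans eq (≈.sym (≈.trans identityˡ identityˡ)))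

  infixr 3 _≈∼_ _∼∼_
  infixl 2 _∼≈_

  _≈∼_ : {f f′ : A ⇒ X ^ m} {g : A ⇒ X ^ n} → f ≈ f′ → X ∣ m ∣ n ⊢ f′ ∼ g → X ∣ m ∣ n ⊢ f ∼ g
  p ≈∼ shuffled size w q = shuffled size w (≈.trans p q)

  _∼≈_ : {f : A ⇒ X ^ m} {g g′ : A ⇒ X ^ n} → X ∣ m ∣ n ⊢ f ∼ g → g ≈ g′ → X ∣ m ∣ n ⊢ f ∼ g′
  shuffled size w q ∼≈ p = shuffled size w (≈.trans q (refl⟩∘⟨ refl⟩∘⟨ p))

  _∼∼_ : {f : A ⇒ X ^ l} {g : A ⇒ X ^ m} {h : A ⇒ X ^ n} →
    X ∣ l ∣ m ⊢ f ∼ g → X ∣ m ∣ n ⊢ g ∼ h → X ∣ l ∣ n ⊢ f ∼ h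
  _∼∼_ {f = f} {g = g} {h = h} (shuffled refl v p) (shuffled refl w q) = shuffled refl (v ∙ w) (begin
    f                                   ≈⟨ p ⟩
    shuffle v ∘ id ∘ g                  ≈⟨ refl⟩∘⟨ ≈.trans identityˡ q ⟩
    shuffle v ∘ shuffle w ∘ id ∘ h      ≈⟨ assoc ⟨
    (shuffle v ∘ shuffle w) ∘ id ∘ h    ∎)

  ∼-∘ : {f : A ⇒ X ^ m} {g : A ⇒ X ^ n} {h : B ⇒ A} → X ∣ m ∣ n ⊢ f ∼ g → X ∣ m ∣ n ⊢ f ∘ h ∼ g ∘ h
  ∼-∘ (shuffled size w p) = shuffled size w
    (≈.trans (p ⟩∘⟨refl) (≈.trans assoc (refl⟩∘⟨ assoc)))

  ∼-⊗ : {f : A ⇒ X ^ m} {g : A ⇒ X ^ n} {h : B ⇒ X} → X ∣ m ∣ n ⊢ f ∼ g → X ∣ suc m ∣ suc n ⊢ h ⊗₁ f ∼ h ⊗₁ g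
  ∼-⊗ {f = f} {g = g} {h = h} (shuffled refl w p) = shuffled refl (keep w) (begin
    h ⊗₁ f                            ≈⟨ ⊗-resp-≈ ≈.refl (≈.trans p (refl⟩∘⟨ identityˡ)) ⟩
    h ⊗₁ (shuffle w ∘ g)              ≈⟨ id⊗-∘ ⟨
    (id ⊗₁ shuffle w) ∘ (h ⊗₁ g)      ≈⟨ refl⟩∘⟨ identityˡ ⟨
    (id ⊗₁ shuffle w) ∘ id ∘ (h ⊗₁ g) ∎)

  -- `acc` absorbs the word. The coercion is along a given `eq` instead of the recorded `size`:
  -- equality proofs between numbers are unique, so the one named in a graded monad law can be
  -- supplied.
  acc-∼ : {f : A ⇒ X ^ m} {g : A ⇒ X ^ n} → X ∣ m ∣ n ⊢ f ∼ g → (eq : n ≡ m) → acc m ∘ f ≈ coerce category M₀ eq ∘ acc n ∘ g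
  acc-∼ {m = m} {f = f} {g = g} (shuffled refl w p) refl = begin
    acc m ∘ f                          ≈⟨ refl⟩∘⟨ p ⟩
    acc m ∘ shuffle w ∘ id ∘ g         ≈⟨ pullˡ (acc-shuffle m w) ⟩
    acc m ∘ id ∘ g                     ≈⟨ refl⟩∘⟨ identityˡ ⟩
    acc m ∘ g                          ≈⟨ identityˡ ⟨
    id ∘ acc m ∘ g                     ∎

  assoc-naturalʳ : ∀ {f : D ⇒ Z} → assoc⇒ {A} {B} ∘ (id ⊗₁ f) ≈ (id ⊗₁ (id ⊗₁ f)) ∘ assoc⇒
  assoc-naturalʳ = ≈.trans (refl⟩∘⟨ ⊗-resp-≈ (≈.sym ⊗-id) ≈.refl) assoc-natural

  shiftWord : ∀ K → Word m → Word (K + m)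
  shiftWord zero    w = w
  shiftWord (suc K) w = keep (shiftWord K w)

  widenWord : ∀ {K} → Word K → Word (K + m)
  widenWord idle     = idle
  widenWord (v ∙ w)  = widenWord v ∙ widenWord w
  widenWord (keep w) = keep (widenWord w)
  widenWord swap     = swap

  ++-shuffleʳ : ∀ K (w : Word m) → ++ K m {X} ∘ (id ⊗₁ shuffle w) ≈ shuffle (shiftWord K w) ∘ ++ K m
  ++-shuffleʳ zero    w = unitˡ-natural
  ++-shuffleʳ {m} (suc K) w = begin
    ((id ⊗₁ ++ K m) ∘ assoc⇒) ∘ (id ⊗₁ shuffle w)          ≈⟨ pullʳ assoc-naturalʳ ⟩
    (id ⊗₁ ++ K m) ∘ (id ⊗₁ (id ⊗₁ shuffle w)) ∘ assoc⇒    ≈⟨ extendʳ (id⊗-natural (++-shuffleʳ K w)) ⟩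
    (id ⊗₁ shuffle (shiftWord K w)) ∘ (id ⊗₁ ++ K m) ∘ assoc⇒ ∎

  ++-shuffleˡ : ∀ {K} m (w : Word K) → ++ K m {X} ∘ (shuffle w ⊗₁ id) ≈ shuffle (widenWord w) ∘ ++ K m
  ++-shuffleˡ m idle = ≈.trans (refl⟩∘⟨ ⊗-id) (≈.trans identityʳ (≈.sym identityˡ))
  ++-shuffleˡ {K = K} m (v ∙ w) = begin
    ++ K m ∘ ((shuffle v ∘ shuffle w) ⊗₁ id)           ≈⟨ refl⟩∘⟨ ⊗id-∘ ⟨
    ++ K m ∘ (shuffle v ⊗₁ id) ∘ (shuffle w ⊗₁ id)     ≈⟨ extendʳ (++-shuffleˡ m v) ⟩
    shuffle (widenWord v) ∘ ++ K m ∘ (shuffle w ⊗₁ id)  ≈⟨ refl⟩∘⟨ ++-shuffleˡ m w ⟩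
    shuffle (widenWord v) ∘ shuffle (widenWord w) ∘ ++ K m  ≈⟨ assoc ⟨
    (shuffle (widenWord v) ∘ shuffle (widenWord w)) ∘ ++ K m  ∎
  ++-shuffleˡ {K = suc K} m (keep w) = begin
    ((id ⊗₁ ++ K m) ∘ assoc⇒) ∘ ((id ⊗₁ shuffle w) ⊗₁ id)   ≈⟨ pullʳ assoc-natural ⟩
    (id ⊗₁ ++ K m) ∘ (id ⊗₁ (shuffle w ⊗₁ id)) ∘ assoc⇒     ≈⟨ extendʳ (id⊗-natural (++-shuffleˡ m w)) ⟩
    (id ⊗₁ shuffle (widenWord w)) ∘ (id ⊗₁ ++ K m) ∘ assoc⇒ ∎
  ++-shuffleˡ {K = suc (suc K)} m swap = begin
    ((id ⊗₁ ((id ⊗₁ ++ K m) ∘ assoc⇒)) ∘ assoc⇒) ∘ (exchange ⊗₁ id)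
      ≈⟨ ≈.trans assoc (pushˡ (≈.sym id⊗-∘)) ⟩
    (id ⊗₁ (id ⊗₁ ++ K m)) ∘ (id ⊗₁ assoc⇒) ∘ assoc⇒ ∘ (exchange ⊗₁ id)
      ≈⟨ refl⟩∘⟨ exchange⊗id ⟩
    (id ⊗₁ (id ⊗₁ ++ K m)) ∘ exchange ∘ (id ⊗₁ assoc⇒) ∘ assoc⇒
      ≈⟨ extendʳ (≈.sym exchange-natural) ⟩
    exchange ∘ (id ⊗₁ (id ⊗₁ ++ K m)) ∘ (id ⊗₁ assoc⇒) ∘ assoc⇒
      ≈⟨ refl⟩∘⟨ pullˡ id⊗-∘ ⟩
    exchange ∘ (id ⊗₁ ((id ⊗₁ ++ K m) ∘ assoc⇒)) ∘ assoc⇒ ∎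

  ++-congʳ : ∀ K {f : A ⇒ X ^ m} {g : A ⇒ X ^ n} {h : B ⇒ X ^ K} → X ∣ m ∣ n ⊢ f ∼ g →
    X ∣ K + m ∣ K + n ⊢ ++ K m ∘ (h ⊗₁ f) ∼ ++ K n ∘ (h ⊗₁ g)
  ++-congʳ {m = m} K {f} {g} {h} (shuffled refl w p) = shuffled refl (shiftWord K w) (begin
    ++ K m ∘ (h ⊗₁ f)                        ≈⟨ refl⟩∘⟨ ⊗-resp-≈ ≈.refl (≈.trans p (refl⟩∘⟨ identityˡ)) ⟩
    ++ K m ∘ (h ⊗₁ (shuffle w ∘ g))          ≈⟨ refl⟩∘⟨ id⊗-∘ ⟨
    ++ K m ∘ (id ⊗₁ shuffle w) ∘ (h ⊗₁ g)    ≈⟨ extendʳ (++-shuffleʳ K w) ⟩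
    shuffle (shiftWord K w) ∘ ++ K m ∘ (h ⊗₁ g)       ≈⟨ refl⟩∘⟨ identityˡ ⟨
    shuffle (shiftWord K w) ∘ id ∘ ++ K m ∘ (h ⊗₁ g)  ∎)

  ++-natural : ∀ K L {X Y} (f : X ⇒ Y) → ++ K L ∘ (f ^₁ K ⊗₁ f ^₁ L) ≈ f ^₁ (K + L) ∘ ++ K L
  ++-natural zero    L f = unitˡ-natural
  ++-natural (suc K) L f = begin
    ((id ⊗₁ ++ K L) ∘ assoc⇒) ∘ ((f ⊗₁ f ^₁ K) ⊗₁ f ^₁ L)  ≈⟨ pullʳ assoc-natural ⟩
    (id ⊗₁ ++ K L) ∘ (f ⊗₁ (f ^₁ K ⊗₁ f ^₁ L)) ∘ assoc⇒    ≈⟨ extendʳ (id⊗-natural (++-natural K L f)) ⟩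
    (f ⊗₁ f ^₁ (K + L)) ∘ (id ⊗₁ ++ K L) ∘ assoc⇒          ∎

  -- No factor moves here; `∼` bridges the two different sizes. The base case is `unitˡ-assoc`, the
  -- induction step the pentagon.
  ++-assoc : ∀ K L N {X} → X ∣ (K + L) + N ∣ K + (L + N) ⊢
    ++ (K + L) N ∘ (++ K L ⊗₁ id) ∼ ++ K (L + N) ∘ (id ⊗₁ ++ L N) ∘ assoc⇒
  ++-assoc zero    L N = ≈⇒∼ (begin
    ++ L N ∘ (unitˡ⇒ ⊗₁ id)                ≈⟨ refl⟩∘⟨ unitˡ-assoc ⟨
    ++ L N ∘ unitˡ⇒ ∘ assoc⇒               ≈⟨ extendʳ (≈.sym unitˡ-natural) ⟩
    unitˡ⇒ ∘ (id ⊗₁ ++ L N) ∘ assoc⇒       ∎)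
  ++-assoc (suc K) L N =
    (begin
      ((id ⊗₁ ++ (K + L) N) ∘ assoc⇒) ∘ (((id ⊗₁ ++ K L) ∘ assoc⇒) ⊗₁ id)
        ≈⟨ ≈.trans assoc (refl⟩∘⟨ refl⟩∘⟨ ≈.sym ⊗id-∘) ⟩
      (id ⊗₁ ++ (K + L) N) ∘ assoc⇒ ∘ ((id ⊗₁ ++ K L) ⊗₁ id) ∘ (assoc⇒ ⊗₁ id)
        ≈⟨ refl⟩∘⟨ extendʳ assoc-natural ⟩
      (id ⊗₁ ++ (K + L) N) ∘ (id ⊗₁ (++ K L ⊗₁ id)) ∘ assoc⇒ ∘ (assoc⇒ ⊗₁ id)
        ≈⟨ pullˡ id⊗-∘ ⟩
      (id ⊗₁ (++ (K + L) N ∘ (++ K L ⊗₁ id))) ∘ assoc⇒ ∘ (assoc⇒ ⊗₁ id) ∎)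
    ≈∼ ∼-∘ (∼-⊗ (++-assoc K L N))
    ∼≈ (begin
      (id ⊗₁ (++ K (L + N) ∘ (id ⊗₁ ++ L N) ∘ assoc⇒)) ∘ assoc⇒ ∘ (assoc⇒ ⊗₁ id)
        ≈⟨ ≈.trans (refl⟩∘⟨ id⊗-∘) id⊗-∘ ⟩∘⟨refl ⟨
      ((id ⊗₁ ++ K (L + N)) ∘ (id ⊗₁ (id ⊗₁ ++ L N)) ∘ (id ⊗₁ assoc⇒)) ∘ assoc⇒ ∘ (assoc⇒ ⊗₁ id)
        ≈⟨ ≈.trans assoc (refl⟩∘⟨ pullʳ pentagon) ⟩
      (id ⊗₁ ++ K (L + N)) ∘ (id ⊗₁ (id ⊗₁ ++ L N)) ∘ assoc⇒ ∘ assoc⇒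
        ≈⟨ ≈.trans assoc (refl⟩∘⟨ extendʳ assoc-naturalʳ) ⟨
      ((id ⊗₁ ++ K (L + N)) ∘ assoc⇒) ∘ (id ⊗₁ ++ L N) ∘ assoc⇒ ∎)

  ++-unitʳ : ∀ K {X} → X ∣ K + 0 ∣ K ⊢ ++ K 0 ∼ unitʳ⇒
  ++-unitʳ zero    = ≈⇒∼ discard-unique
  ++-unitʳ (suc K) = ∼-∘ (∼-⊗ (++-unitʳ K)) ∼≈ assoc-unitʳ

  -- A factor placed between two tuples can be brought to the front: `exchange-⊗ʳ` lets it pass the
  -- first tuple one factor at a time, each passage contributing a `swap`.
  ++-insert : ∀ L N {X} → X ∣ L + suc N ∣ suc (L + N) ⊢
    ++ L (suc N) ∘ exchange ∼ id ⊗₁ ++ L N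
  ++-insert zero    N = ≈⇒∼ unitˡ-exchange
  ++-insert (suc L) N =
    (begin
      ((id ⊗₁ ++ L (suc N)) ∘ assoc⇒) ∘ exchange                            ≈⟨ pullʳ exchange-⊗ʳ ⟩
      (id ⊗₁ ++ L (suc N)) ∘ (id ⊗₁ exchange) ∘ exchange ∘ (id ⊗₁ assoc⇒)   ≈⟨ pullˡ id⊗-∘ ⟩
      (id ⊗₁ (++ L (suc N) ∘ exchange)) ∘ exchange ∘ (id ⊗₁ assoc⇒)         ∎)
    ≈∼ ∼-∘ (∼-⊗ (++-insert L N))
    ∼∼ shuffled refl swap (begin
      (id ⊗₁ (id ⊗₁ ++ L N)) ∘ exchange ∘ (id ⊗₁ assoc⇒)     ≈⟨ extendʳ exchange-natural ⟨
      exchange ∘ (id ⊗₁ (id ⊗₁ ++ L N)) ∘ (id ⊗₁ assoc⇒)     ≈⟨ refl⟩∘⟨ ≈.trans id⊗-∘ (≈.sym identityˡ) ⟩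
      exchange ∘ id ∘ (id ⊗₁ ((id ⊗₁ ++ L N) ∘ assoc⇒))      ∎)

  -- The `K`-tuple is moved factor by factor: `exchange-⊗ˡ` splits off its first factor, `++-insert`
  -- brings that to the front, and the rest is the induction hypothesis.
  ++-exchange : ∀ K L N {X} → X ∣ L + (K + N) ∣ K + (L + N) ⊢
    ++ L (K + N) ∘ (id ⊗₁ ++ K N) ∘ exchange ∼ ++ K (L + N) ∘ (id ⊗₁ ++ L N)
  ++-exchange zero    L N = ≈⇒∼ (≈.trans (refl⟩∘⟨ exchange-unitˡ) (≈.sym unitˡ-natural))
  ++-exchange (suc K) L N =
    (begin
      ++ L (suc K + N) ∘ (id ⊗₁ ((id ⊗₁ ++ K N) ∘ assoc⇒)) ∘ exchange
        ≈⟨ refl⟩∘⟨ pushˡ (≈.sym id⊗-∘) ⟩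
      ++ L (suc K + N) ∘ (id ⊗₁ (id ⊗₁ ++ K N)) ∘ (id ⊗₁ assoc⇒) ∘ exchange
        ≈⟨ refl⟩∘⟨ refl⟩∘⟨ exchange-⊗ˡ ⟩
      ++ L (suc K + N) ∘ (id ⊗₁ (id ⊗₁ ++ K N)) ∘ exchange ∘ (id ⊗₁ exchange) ∘ assoc⇒
        ≈⟨ refl⟩∘⟨ extendʳ exchange-natural ⟨
      ++ L (suc K + N) ∘ exchange ∘ (id ⊗₁ (id ⊗₁ ++ K N)) ∘ (id ⊗₁ exchange) ∘ assoc⇒
        ≈⟨ refl⟩∘⟨ refl⟩∘⟨ pullˡ id⊗-∘ ⟩
      ++ L (suc K + N) ∘ exchange ∘ (id ⊗₁ ((id ⊗₁ ++ K N) ∘ exchange)) ∘ assoc⇒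
        ≈⟨ assoc ⟨
      (++ L (suc K + N) ∘ exchange) ∘ (id ⊗₁ ((id ⊗₁ ++ K N) ∘ exchange)) ∘ assoc⇒ ∎)
    ≈∼ ∼-∘ (++-insert L (K + N))
    ∼∼ pullˡ id⊗-∘
    ≈∼ ∼-∘ (∼-⊗ (++-exchange K L N))
    ∼≈ (begin
      (id ⊗₁ (++ K (L + N) ∘ (id ⊗₁ ++ L N))) ∘ assoc⇒       ≈⟨ pushˡ (≈.sym id⊗-∘) ⟩
      (id ⊗₁ ++ K (L + N)) ∘ (id ⊗₁ (id ⊗₁ ++ L N)) ∘ assoc⇒  ≈⟨ pullʳ assoc-naturalʳ ⟨
      ((id ⊗₁ ++ K (L + N)) ∘ assoc⇒) ∘ (id ⊗₁ ++ L N)       ∎)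

  -- What `sum` becomes on representatives, by `sum-acc`. Unlike `sum`, it has no separate clause
  -- for one summand, which keeps the recursion on `K` uniform.
  concat : ∀ K L {X} → (X ^ L) ^ K ⇒ X ^ (K * L)
  concat zero    L = id
  concat (suc K) L = ++ L (K * L) ∘ (id ⊗₁ concat K L)

  concat-natural : ∀ K L {X Y} (f : X ⇒ Y) → concat K L ∘ (f ^₁ L) ^₁ K ≈ f ^₁ (K * L) ∘ concat K L
  concat-natural zero    L f = ≈.refl
  concat-natural (suc K) L f = begin
    (++ L (K * L) ∘ (id ⊗₁ concat K L)) ∘ (f ^₁ L ⊗₁ (f ^₁ L) ^₁ K)
      ≈⟨ pullʳ (id⊗-natural (concat-natural K L f)) ⟩
    ++ L (K * L) ∘ (f ^₁ L ⊗₁ f ^₁ (K * L)) ∘ (id ⊗₁ concat K L)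
      ≈⟨ extendʳ (++-natural L (K * L) f) ⟩
    f ^₁ (L + K * L) ∘ ++ L (K * L) ∘ (id ⊗₁ concat K L) ∎

  -- Checked on generators: a `swap` interchanges two neighbouring blocks of length `L`, and this is
  -- `++-exchange`.
  concat-shuffle : ∀ K L {X} (w : Word K) →
    X ∣ K * L ∣ K * L ⊢ concat K L ∘ shuffle w ∼ concat K L
  concat-shuffle K L idle = ≈⇒∼ identityʳ
  concat-shuffle K L (v ∙ w) =
    ≈.sym assoc ≈∼ ∼-∘ (concat-shuffle K L v) ∼∼ concat-shuffle K L w
  concat-shuffle (suc K) L (keep w) =
    pullʳ id⊗-∘ ≈∼ ++-congʳ L (concat-shuffle K L w)
  concat-shuffle (suc (suc K)) L swap =
    (begin
      (++ L (L + K * L) ∘ (id ⊗₁ (++ L (K * L) ∘ (id ⊗₁ concat K L)))) ∘ exchange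
        ≈⟨ pullʳ (pushˡ (≈.sym id⊗-∘)) ⟩
      ++ L (L + K * L) ∘ (id ⊗₁ ++ L (K * L)) ∘ (id ⊗₁ (id ⊗₁ concat K L)) ∘ exchange
        ≈⟨ refl⟩∘⟨ refl⟩∘⟨ exchange-natural ⟨
      ++ L (L + K * L) ∘ (id ⊗₁ ++ L (K * L)) ∘ exchange ∘ (id ⊗₁ (id ⊗₁ concat K L))
        ≈⟨ ≈.trans assoc (refl⟩∘⟨ assoc) ⟨
      (++ L (L + K * L) ∘ (id ⊗₁ ++ L (K * L)) ∘ exchange) ∘ (id ⊗₁ (id ⊗₁ concat K L)) ∎)
    ≈∼ ∼-∘ (++-exchange L L (K * L))
    ∼≈ pullʳ id⊗-∘

  concat-++ : ∀ K L N {X} → X ∣ K * N + L * N ∣ (K + L) * N ⊢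
    ++ (K * N) (L * N) ∘ (concat K N ⊗₁ concat L N) ∼ concat (K + L) N ∘ ++ K L
  concat-++ zero    L N = ≈⇒∼ unitˡ-natural
  concat-++ (suc K) L N =
    (begin
      ++ (N + K * N) (L * N) ∘ ((++ N (K * N) ∘ (id ⊗₁ concat K N)) ⊗₁ concat L N)
        ≈⟨ pushʳ (≈.sym ⊗id-∘) ⟩
      (++ (N + K * N) (L * N) ∘ (++ N (K * N) ⊗₁ id)) ∘ ((id ⊗₁ concat K N) ⊗₁ concat L N) ∎)
    ≈∼ ∼-∘ (++-assoc N (K * N) (L * N))
    ∼∼ (begin
      (++ N (K * N + L * N) ∘ (id ⊗₁ ++ (K * N) (L * N)) ∘ assoc⇒) ∘ ((id ⊗₁ concat K N) ⊗₁ concat L N)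
        ≈⟨ pullʳ (pullʳ assoc-natural) ⟩
      ++ N (K * N + L * N) ∘ (id ⊗₁ ++ (K * N) (L * N)) ∘ (id ⊗₁ (concat K N ⊗₁ concat L N)) ∘ assoc⇒
        ≈⟨ ≈.trans assoc (refl⟩∘⟨ pushˡ (≈.sym id⊗-∘)) ⟨
      (++ N (K * N + L * N) ∘ (id ⊗₁ (++ (K * N) (L * N) ∘ (concat K N ⊗₁ concat L N)))) ∘ assoc⇒ ∎)
    ≈∼ ∼-∘ (++-congʳ N (concat-++ K L N))
    ∼≈ (begin
      (++ N ((K + L) * N) ∘ (id ⊗₁ (concat (K + L) N ∘ ++ K L))) ∘ assoc⇒
        ≈⟨ pullʳ (pushˡ (≈.sym id⊗-∘)) ⟩
      ++ N ((K + L) * N) ∘ (id ⊗₁ concat (K + L) N) ∘ (id ⊗₁ ++ K L) ∘ assoc⇒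
        ≈⟨ assoc ⟨
      (++ N ((K + L) * N) ∘ (id ⊗₁ concat (K + L) N)) ∘ (id ⊗₁ ++ K L) ∘ assoc⇒ ∎)

  concat-concat : ∀ K L N {X} → X ∣ K * (L * N) ∣ (K * L) * N ⊢
    concat K (L * N) ∘ concat L N ^₁ K ∼ concat (K * L) N ∘ concat K L
  concat-concat zero    L N = ≈⇒∼ ≈.refl
  concat-concat (suc K) L N =
    pullʳ id⊗-∘
    ≈∼ ++-congʳ (L * N) (concat-concat K L N)
    -- Splits off `concat K L`, which leaves a concatenation of two flattened tuples for
    -- `concat-++`.
    ∼∼ pushʳ (≈.trans (⊗-resp-≈ (≈.sym identityʳ) ≈.refl) ⊗-∘)
    ≈∼ ∼-∘ (concat-++ L (K * L) N)
    ∼≈ assoc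

  concat-unit : ∀ K {X} → X ∣ K ∣ K * 1 ⊢ id ∼ concat K 1 ∘ unitʳ⇐ ^₁ K
  concat-unit zero    = ≈⇒∼ (≈.sym identityˡ)
  concat-unit (suc K) =
    ≈.sym ⊗-id
    ≈∼ ∼-⊗ (concat-unit K)
    ∼≈ (begin
      id ⊗₁ (concat K 1 ∘ unitʳ⇐ ^₁ K)
        ≈⟨ ⊗-resp-≈ unitʳ-isoʳ ≈.refl ⟨
      (unitʳ⇒ ∘ unitʳ⇐) ⊗₁ (concat K 1 ∘ unitʳ⇐ ^₁ K)
        ≈⟨ ⊗id-∘ ⟨
      (unitʳ⇒ ⊗₁ id) ∘ (unitʳ⇐ ⊗₁ (concat K 1 ∘ unitʳ⇐ ^₁ K))
        -- `++ 1 (K * 1)` unfolds to `(id ⊗₁ unitˡ⇒) ∘ assoc⇒`, one side of the triangle.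
        ≈⟨ ≈.sym triangle ⟩∘⟨refl ⟩
      ((id ⊗₁ unitˡ⇒) ∘ assoc⇒) ∘ (unitʳ⇐ ⊗₁ (concat K 1 ∘ unitʳ⇐ ^₁ K))
        ≈⟨ pullʳ id⊗-∘ ⟨
      (((id ⊗₁ unitˡ⇒) ∘ assoc⇒) ∘ (id ⊗₁ concat K 1)) ∘ (unitʳ⇐ ⊗₁ unitʳ⇐ ^₁ K) ∎)

-- Functoriality and determinism of accumulation

module SumsOfMultisets {o ℓ e} (𝐂 : UniformMarkovCategory o ℓ e) where
  open UniformMarkovCategory 𝐂
  open Multisets 𝐂
  open Composition category
  open Coherence symmetricMonoidal
  open Determinism 𝐂
  open Shuffles 𝐂
  open Concatenation 𝐂

  private variable
    X Y Z : Obj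

  ^₁-cong : ∀ K {f g : X ⇒ Y} → f ≈ g → f ^₁ K ≈ g ^₁ K
  ^₁-cong zero    eq = ≈.refl
  ^₁-cong (suc K) eq = ⊗-resp-≈ eq (^₁-cong K eq)

  ^₁-id : ∀ K → id {X} ^₁ K ≈ id
  ^₁-id zero    = ≈.refl
  ^₁-id (suc K) = ≈.trans (⊗-resp-≈ ≈.refl (^₁-id K)) ⊗-id

  ^₁-∘ : ∀ K {f : X ⇒ Y} {g : Y ⇒ Z} → (g ∘ f) ^₁ K ≈ g ^₁ K ∘ f ^₁ K
  ^₁-∘ zero    = ≈.sym identityˡ
  ^₁-∘ (suc K) = ≈.trans (⊗-resp-≈ ≈.refl (^₁-∘ K)) ⊗-∘

  ^₁-split : ∀ K {q : X ⇒ Y} {s : Y ⇒ X} → q ∘ s ≈ id → q ^₁ K ∘ s ^₁ K ≈ id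
  ^₁-split K split = ≈.trans (≈.sym (^₁-∘ K)) (≈.trans (^₁-cong K split) (^₁-id K))

  acc-epi : ∀ K {h k : M₀ K X ⇒ Z} → h ∘ acc K ≈ k ∘ acc K → h ≈ k
  acc-epi {X} K = IsCoequaliser.unique (acc-isCoequaliser K X)

  M₁-cong : ∀ K {f g : X ⇒ Y} → f ≈ g → M₁ K f ≈ M₁ K g
  M₁-cong K {f} {g} eq = acc-epi K
    (≈.trans (M₁-acc K f) (≈.trans (refl⟩∘⟨ ^₁-cong K eq) (≈.sym (M₁-acc K g))))

  M₁-id : ∀ K → M₁ K (id {X}) ≈ id
  M₁-id K = acc-epi K
    (≈.trans (M₁-acc K id) (≈.trans (refl⟩∘⟨ ^₁-id K) (≈.trans identityʳ (≈.sym identityˡ))))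

  M₁-∘ : ∀ K {f : X ⇒ Y} {g : Y ⇒ Z} → M₁ K (g ∘ f) ≈ M₁ K g ∘ M₁ K f
  M₁-∘ K {f} {g} = acc-epi K (begin
    M₁ K (g ∘ f) ∘ acc K          ≈⟨ M₁-acc K (g ∘ f) ⟩
    acc K ∘ (g ∘ f) ^₁ K          ≈⟨ refl⟩∘⟨ ^₁-∘ K ⟩
    acc K ∘ g ^₁ K ∘ f ^₁ K       ≈⟨ extendʳ (M₁-acc K g) ⟨
    M₁ K g ∘ acc K ∘ f ^₁ K       ≈⟨ pullʳ (M₁-acc K f) ⟨
    (M₁ K g ∘ M₁ K f) ∘ acc K     ∎)

  shuffle-det : ∀ {K} (w : Word K) → Deterministic (shuffle {X = X} w)
  shuffle-det idle     = id-det
  shuffle-det (v ∙ w)  = ∘-det _ _ (shuffle-det v) (shuffle-det w)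
  shuffle-det (keep w) = ⊗-det _ _ id-det (shuffle-det w)
  shuffle-det swap     = exchange-det

  -- `leg-det` asks for a diagram of deterministic maps; each `permute` qualifies because it equals
  -- the action of a word.
  acc-det : ∀ K → Deterministic (acc K {X})
  acc-det {X} K = leg-det (parallel category (λ k → permute {K} {X} (enumerate K k)))
    (λ k → resp-det (≈.reflexive (shuffle-fromPermutation (enumerate K k)))
      (shuffle-det (fromPermutation (enumerate K k))))
    (suc zero)

  ++-det : ∀ K L → Deterministic (++ K L {X})
  ++-det zero    L = unitˡ-det
  ++-det (suc K) L = ∘-det _ _ (⊗-det _ _ id-det (++-det K L)) assoc-det

  η-natural : (f : X ⇒ Y) → η Y ∘ f ≈ M₁ 1 f ∘ η X
  η-natural f = begin
    (acc 1 ∘ unitʳ⇐) ∘ f            ≈⟨ pullʳ unitʳ⇐-natural ⟩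
    acc 1 ∘ (f ⊗₁ id) ∘ unitʳ⇐      ≈⟨ extendʳ (M₁-acc 1 f) ⟨
    M₁ 1 f ∘ acc 1 ∘ unitʳ⇐         ∎

  coerce-sym : ∀ (T : ℕ → Obj → Obj) {m n} (eq : m ≡ n) (eq′ : n ≡ m) →
    coerce category T {A = X} eq ∘ coerce category T eq′ ≈ id
  coerce-sym T refl refl = identityˡ

  -- The two permutations act on disjoint blocks of the concatenation, as the words `widenWord v`
  -- and `shiftWord K w`, and `acc (K + L)` absorbs both.
  acc-++-permute : ∀ K L (σ : Permutation′ K) (τ : Permutation′ L) →
    (acc (K + L) {X} ∘ ++ K L) ∘ (permute σ ⊗₁ permute τ) ≈ acc (K + L) ∘ ++ K L
  acc-++-permute K L σ τ = begin
    (acc (K + L) ∘ ++ K L) ∘ (permute σ ⊗₁ permute τ)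
      ≈⟨ refl⟩∘⟨ ≈.reflexive (≡.cong₂ _⊗₁_ (shuffle-fromPermutation σ) (shuffle-fromPermutation τ)) ⟨
    (acc (K + L) ∘ ++ K L) ∘ (shuffle v ⊗₁ shuffle w)
      ≈⟨ refl⟩∘⟨ ≈.trans ⊗id-∘ (⊗-resp-≈ identityʳ ≈.refl) ⟨
    (acc (K + L) ∘ ++ K L) ∘ (shuffle v ⊗₁ id) ∘ (id ⊗₁ shuffle w)
      ≈⟨ pullʳ (extendʳ (++-shuffleˡ L v)) ⟩
    acc (K + L) ∘ shuffle (widenWord v) ∘ ++ K L ∘ (id ⊗₁ shuffle w)
      ≈⟨ pullˡ (acc-shuffle (K + L) (widenWord v)) ⟩
    acc (K + L) ∘ ++ K L ∘ (id ⊗₁ shuffle w)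
      ≈⟨ refl⟩∘⟨ ++-shuffleʳ K w ⟩
    acc (K + L) ∘ shuffle (shiftWord K w) ∘ ++ K L
      ≈⟨ pullˡ (acc-shuffle (K + L) (shiftWord K w)) ⟩
    acc (K + L) ∘ ++ K L ∎
    where
    v = fromPermutation σ
    w = fromPermutation τ

  -- Sums and multiplication computed on representatives

  module _ (A : Arrangement) (acc⊗acc-isCoequaliser : TensorsOfAccAreCoequalisers) where
    open Arrangement A
    open Sums A

    acc-arr : ∀ K → acc K {X} ∘ arr K ≈ id
    acc-arr K = acc-epi K (begin
      (acc K ∘ arr K) ∘ acc K   ≈⟨ pullʳ (arr-acc K) ⟩
      acc K ∘ perm K            ≈⟨ acc-perm K ⟩
      acc K                     ≈⟨ identityˡ ⟨
      id ∘ acc K                ∎)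

    acc⊗acc-split : ∀ K L → (acc K {X} ⊗₁ acc L {X}) ∘ (arr K ⊗₁ arr L) ≈ id
    acc⊗acc-split K L =
      ≈.trans (≈.sym ⊗-∘) (≈.trans (⊗-resp-≈ (acc-arr K) (acc-arr L)) ⊗-id)

    -- By the hypothesis on tensors, `acc (K + L) ∘ ++ K L` factors through `acc K ⊗₁ acc L` by a
    -- mediating map `m`. As `acc K ⊗₁ acc L` cancels `arr K ⊗₁ arr L`, the map `plus` is equal to
    -- `m`.
    plus-acc : ∀ K L → plus K L {X} ∘ (acc K ⊗₁ acc L) ≈ acc (K + L) ∘ ++ K L
    plus-acc {X} K L = begin
      (acc (K + L) ∘ ++ K L ∘ (arr K ⊗₁ arr L)) ∘ (acc K ⊗₁ acc L)
        ≈⟨ ≈.sym assoc ⟩∘⟨refl ⟩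
      ((acc (K + L) ∘ ++ K L) ∘ (arr K ⊗₁ arr L)) ∘ (acc K ⊗₁ acc L)
        ≈⟨ (≈.sym factor ⟩∘⟨refl) ⟩∘⟨refl ⟩
      ((m ∘ (acc K ⊗₁ acc L)) ∘ (arr K ⊗₁ arr L)) ∘ (acc K ⊗₁ acc L)
        ≈⟨ cancelʳ (acc⊗acc-split K L) ⟩∘⟨refl ⟩
      m ∘ (acc K ⊗₁ acc L)
        ≈⟨ factor ⟩
      acc (K + L) ∘ ++ K L ∎
      where
      open IsCoequaliser (acc⊗acc-isCoequaliser K L X)
      equal = λ (σ , τ) (σ′ , τ′) → ≈.trans (acc-++-permute K L σ τ) (≈.sym (acc-++-permute K L σ′ τ′))
      m = mediate (acc (K + L) ∘ ++ K L) equal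
      factor : m ∘ (acc K ⊗₁ acc L) ≈ acc (K + L) ∘ ++ K L
      factor = mediate-∘ (acc (K + L) ∘ ++ K L) equal

    -- The definition passes through the averaging map `arr`, so determinism is read off `plus-acc`
    -- instead and descends along `acc K ⊗₁ acc L`.
    plus-det : ∀ K L → Deterministic (plus K L {X})
    plus-det K L = split-epi-det (plus K L) (acc K ⊗₁ acc L) (acc⊗acc-split K L)
      (⊗-det _ _ (acc-det K) (acc-det L))
      (resp-det (≈.sym (plus-acc K L)) (∘-det _ _ (acc-det (K + L)) (++-det K L)))

    sum-acc : ∀ K L → sum K L {X} ∘ acc L ^₁ K ≈ acc (K * L) ∘ concat K L
    sum-acc zero          L = ≈.refl
    -- `sum 1` is the identity up to a unitor and a coercion, whereas `concat 1 L` appends an empty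
    -- tuple; `++-unitʳ` reconciles the two.
    sum-acc (suc zero)    L = begin
      (coerce category M₀ eq ∘ unitʳ⇒) ∘ (acc L ⊗₁ id)  ≈⟨ pullʳ unitʳ-natural ⟩
      coerce category M₀ eq ∘ acc L ∘ unitʳ⇒            ≈⟨ acc-∼ (++-unitʳ L) eq ⟨
      acc (L + 0) ∘ ++ L 0                              ≈⟨ refl⟩∘⟨ ≈.trans (refl⟩∘⟨ ⊗-id) identityʳ ⟨
      acc (L + 0) ∘ ++ L 0 ∘ (id ⊗₁ id)                 ∎
      where eq = ≡.sym (*-identityˡ L)
    sum-acc (suc (suc K)) L = begin
      (plus L (suc K * L) ∘ (id ⊗₁ sum (suc K) L)) ∘ (acc L ⊗₁ acc L ^₁ suc K)
        ≈⟨ pullʳ (≈.trans id⊗-∘ (⊗-resp-≈ (≈.sym identityʳ) (sum-acc (suc K) L))) ⟩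
      plus L (suc K * L) ∘ ((acc L ∘ id) ⊗₁ (acc (suc K * L) ∘ concat (suc K) L))
        ≈⟨ refl⟩∘⟨ ⊗-∘ ⟩
      plus L (suc K * L) ∘ (acc L ⊗₁ acc (suc K * L)) ∘ (id ⊗₁ concat (suc K) L)
        ≈⟨ extendʳ (plus-acc L (suc K * L)) ⟩
      acc (L + suc K * L) ∘ ++ L (suc K * L) ∘ (id ⊗₁ concat (suc K) L) ∎

    acc^₁-split : ∀ K L → acc L {X} ^₁ K ∘ arr L ^₁ K ≈ id
    acc^₁-split K L = ^₁-split K (acc-arr L)

    sum-natural : ∀ K L (f : X ⇒ Y) → sum K L ∘ M₁ L f ^₁ K ≈ M₁ (K * L) f ∘ sum K L
    sum-natural K L f = split-epi (acc^₁-split K L) (begin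
      (sum K L ∘ M₁ L f ^₁ K) ∘ acc L ^₁ K         ≈⟨ pullʳ (≈.sym (^₁-∘ K)) ⟩
      sum K L ∘ (M₁ L f ∘ acc L) ^₁ K              ≈⟨ refl⟩∘⟨ ^₁-cong K (M₁-acc L f) ⟩
      sum K L ∘ (acc L ∘ f ^₁ L) ^₁ K              ≈⟨ refl⟩∘⟨ ^₁-∘ K ⟩
      sum K L ∘ acc L ^₁ K ∘ (f ^₁ L) ^₁ K         ≈⟨ extendʳ (sum-acc K L) ⟩
      acc (K * L) ∘ concat K L ∘ (f ^₁ L) ^₁ K     ≈⟨ refl⟩∘⟨ concat-natural K L f ⟩
      acc (K * L) ∘ f ^₁ (K * L) ∘ concat K L      ≈⟨ extendʳ (M₁-acc (K * L) f) ⟨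
      M₁ (K * L) f ∘ acc (K * L) ∘ concat K L      ≈⟨ pullʳ (sum-acc K L) ⟨
      (M₁ (K * L) f ∘ sum K L) ∘ acc L ^₁ K        ∎)

    -- On representatives a permutation of the summands is a permutation of blocks, which
    -- `acc (K * L)` absorbs; commutativity of `plus` is never treated on its own. This is the
    -- condition for `sum` to induce `μ`.
    sum-permute : ∀ K L (σ : Permutation′ K) → sum K L {X} ∘ permute σ ≈ sum K L
    sum-permute K L σ = split-epi (acc^₁-split K L) (begin
      (sum K L ∘ permute σ) ∘ acc L ^₁ K           ≈⟨ pullʳ (permute-natural (acc L) σ) ⟩
      sum K L ∘ acc L ^₁ K ∘ permute σ             ≈⟨ extendʳ (sum-acc K L) ⟩
      acc (K * L) ∘ concat K L ∘ permute σ
        ≈⟨ refl⟩∘⟨ refl⟩∘⟨ ≈.reflexive (shuffle-fromPermutation σ) ⟨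
      acc (K * L) ∘ concat K L ∘ shuffle (fromPermutation σ)
        ≈⟨ acc-∼ (concat-shuffle K L (fromPermutation σ)) refl ⟩
      id ∘ acc (K * L) ∘ concat K L                ≈⟨ identityˡ ⟩
      acc (K * L) ∘ concat K L                     ≈⟨ sum-acc K L ⟨
      sum K L ∘ acc L ^₁ K                         ∎)

    multiplication : Multiplication
    multiplication = record
      { μ     = λ K L X → IsCoequaliser.mediate (acc-isCoequaliser K (M₀ L X)) (sum K L) (equal K L)
      ; μ-acc = λ K L X → IsCoequaliser.mediate-∘ (acc-isCoequaliser K (M₀ L X)) (sum K L) (equal K L)
      }
      where
      equal : ∀ K L {X} (σ τ : Permutation′ K) → sum K L {X} ∘ permute σ ≈ sum K L ∘ permute τ
      equal K L σ τ = ≈.trans (sum-permute K L σ) (≈.sym (sum-permute K L τ))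

    module _ (M : Multiplication) where
      open Multiplication M

      μ-natural : ∀ K L (f : X ⇒ Y) → μ K L Y ∘ M₁ K (M₁ L f) ≈ M₁ (K * L) f ∘ μ K L X
      μ-natural {X} {Y} K L f = acc-epi K (begin
        (μ K L Y ∘ M₁ K (M₁ L f)) ∘ acc K      ≈⟨ pullʳ (M₁-acc K (M₁ L f)) ⟩
        μ K L Y ∘ acc K ∘ M₁ L f ^₁ K          ≈⟨ pullˡ (μ-acc K L Y) ⟩
        sum K L ∘ M₁ L f ^₁ K                  ≈⟨ sum-natural K L f ⟩
        M₁ (K * L) f ∘ sum K L                 ≈⟨ pullʳ (μ-acc K L X) ⟨
        (M₁ (K * L) f ∘ μ K L X) ∘ acc K       ∎)

      μ-identityˡ : ∀ K X → coerce category M₀ (*-identityˡ K) ∘ μ 1 K X ∘ η (M₀ K X) ≈ id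
      μ-identityˡ K X = begin
        coerce category M₀ eq ∘ μ 1 K X ∘ acc 1 ∘ unitʳ⇐     ≈⟨ refl⟩∘⟨ pullˡ (μ-acc 1 K X) ⟩
        coerce category M₀ eq ∘ (coerce category M₀ (≡.sym eq) ∘ unitʳ⇒) ∘ unitʳ⇐
          ≈⟨ refl⟩∘⟨ cancelʳ unitʳ-isoʳ ⟩
        coerce category M₀ eq ∘ coerce category M₀ (≡.sym eq)  ≈⟨ coerce-sym M₀ eq (≡.sym eq) ⟩
        id                                                   ∎
        where eq = *-identityˡ K

      μ-identityʳ : ∀ K X → coerce category M₀ (*-identityʳ K) ∘ μ K 1 X ∘ M₁ K (η X) ≈ id
      μ-identityʳ K X = acc-epi K (begin
        (coerce category M₀ eq ∘ μ K 1 X ∘ M₁ K (η X)) ∘ acc K     ≈⟨ pullʳ (pullʳ (M₁-acc K (η X))) ⟩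
        coerce category M₀ eq ∘ μ K 1 X ∘ acc K ∘ η X ^₁ K         ≈⟨ refl⟩∘⟨ pullˡ (μ-acc K 1 X) ⟩
        coerce category M₀ eq ∘ sum K 1 ∘ (acc 1 ∘ unitʳ⇐) ^₁ K    ≈⟨ refl⟩∘⟨ refl⟩∘⟨ ^₁-∘ K ⟩
        coerce category M₀ eq ∘ sum K 1 ∘ acc 1 ^₁ K ∘ unitʳ⇐ ^₁ K  ≈⟨ refl⟩∘⟨ extendʳ (sum-acc K 1) ⟩
        coerce category M₀ eq ∘ acc (K * 1) ∘ concat K 1 ∘ unitʳ⇐ ^₁ K  ≈⟨ acc-∼ (concat-unit K) eq ⟨
        acc K ∘ id                                                 ≈⟨ ≈.trans identityʳ (≈.sym identityˡ) ⟩
        id ∘ acc K                                                 ∎)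
        where eq = *-identityʳ K

      -- Precomposition with `acc K`, `acc L ^₁ K` and `(acc N ^₁ L) ^₁ K` chooses representatives
      -- on all three levels. What remains are the two ways to flatten a `K`-tuple of `L`-tuples of
      -- `N`-tuples, compared by `concat-concat`.
      μ-assoc : ∀ K L N X →
        coerce category M₀ (*-assoc K L N) ∘ μ (K * L) N X ∘ μ K L (M₀ N X) ≈ μ K (L * N) X ∘ M₁ K (μ L N X)
      μ-assoc K L N X =
        acc-epi K (split-epi (acc^₁-split K L) (split-epi (^₁-split K (acc^₁-split L N)) (begin
          (((coerce category M₀ eq ∘ μ (K * L) N X ∘ μ K L (M₀ N X)) ∘ acc K) ∘ acc L ^₁ K) ∘ (acc N ^₁ L) ^₁ K
            ≈⟨ lhs ⟩
          coerce category M₀ eq ∘ acc ((K * L) * N) ∘ concat (K * L) N ∘ concat K L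
            ≈⟨ acc-∼ (concat-concat K L N) eq ⟨
          acc (K * (L * N)) ∘ concat K (L * N) ∘ concat L N ^₁ K
            ≈⟨ rhs ⟨
          (((μ K (L * N) X ∘ M₁ K (μ L N X)) ∘ acc K) ∘ acc L ^₁ K) ∘ (acc N ^₁ L) ^₁ K ∎)))
        where
        eq = *-assoc K L N

        lhs : (((coerce category M₀ eq ∘ μ (K * L) N X ∘ μ K L (M₀ N X)) ∘ acc K) ∘ acc L ^₁ K) ∘ (acc N ^₁ L) ^₁ K
              ≈ coerce category M₀ eq ∘ acc ((K * L) * N) ∘ concat (K * L) N ∘ concat K L
        lhs = begin
          (((coerce category M₀ eq ∘ μ (K * L) N X ∘ μ K L (M₀ N X)) ∘ acc K) ∘ acc L ^₁ K) ∘ (acc N ^₁ L) ^₁ K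
            ≈⟨ pullʳ (pullʳ (μ-acc K L (M₀ N X))) ⟩∘⟨refl ⟩∘⟨refl ⟩
          ((coerce category M₀ eq ∘ μ (K * L) N X ∘ sum K L) ∘ acc L ^₁ K) ∘ (acc N ^₁ L) ^₁ K
            ≈⟨ pullʳ (pullʳ (sum-acc K L)) ⟩∘⟨refl ⟩
          (coerce category M₀ eq ∘ μ (K * L) N X ∘ acc (K * L) ∘ concat K L) ∘ (acc N ^₁ L) ^₁ K
            -- Sliding past `concat K L` turns the nested power of `acc N` into `acc N ^₁ (K * L)`,
            -- to which `sum-acc` applies.
            ≈⟨ pullʳ (≈.trans (pullˡ (μ-acc (K * L) N X) ⟩∘⟨refl) (pullʳ (concat-natural K L (acc N)))) ⟩
          coerce category M₀ eq ∘ sum (K * L) N ∘ acc N ^₁ (K * L) ∘ concat K L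
            ≈⟨ refl⟩∘⟨ extendʳ (sum-acc (K * L) N) ⟩
          coerce category M₀ eq ∘ acc ((K * L) * N) ∘ concat (K * L) N ∘ concat K L ∎

        rhs : (((μ K (L * N) X ∘ M₁ K (μ L N X)) ∘ acc K) ∘ acc L ^₁ K) ∘ (acc N ^₁ L) ^₁ K
              ≈ acc (K * (L * N)) ∘ concat K (L * N) ∘ concat L N ^₁ K
        rhs = begin
          (((μ K (L * N) X ∘ M₁ K (μ L N X)) ∘ acc K) ∘ acc L ^₁ K) ∘ (acc N ^₁ L) ^₁ K
            ≈⟨ pullʳ (M₁-acc K (μ L N X)) ⟩∘⟨refl ⟩∘⟨refl ⟩
          ((μ K (L * N) X ∘ acc K ∘ μ L N X ^₁ K) ∘ acc L ^₁ K) ∘ (acc N ^₁ L) ^₁ K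
            ≈⟨ pullˡ (μ-acc K (L * N) X) ⟩∘⟨refl ⟩∘⟨refl ⟩
          ((sum K (L * N) ∘ μ L N X ^₁ K) ∘ acc L ^₁ K) ∘ (acc N ^₁ L) ^₁ K
            ≈⟨ pullʳ (≈.trans (≈.sym (^₁-∘ K)) (^₁-cong K (μ-acc L N X))) ⟩∘⟨refl ⟩
          (sum K (L * N) ∘ sum L N ^₁ K) ∘ (acc N ^₁ L) ^₁ K
            ≈⟨ pullʳ (≈.trans (≈.sym (^₁-∘ K)) (≈.trans (^₁-cong K (sum-acc L N)) (^₁-∘ K))) ⟩
          sum K (L * N) ∘ acc (L * N) ^₁ K ∘ concat L N ^₁ K
            ≈⟨ extendʳ (sum-acc K (L * N)) ⟩
          acc (K * (L * N)) ∘ concat K (L * N) ∘ concat L N ^₁ K ∎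

      isGradedMonad : IsGradedMonad category M₀ M₁ η μ
      isGradedMonad = record
        { resp-≈       = λ K → M₁-cong K
        ; identity     = λ K → M₁-id K
        ; homomorphism = λ K → M₁-∘ K
        ; η-natural    = η-natural
        ; μ-natural    = λ K L → μ-natural K L
        ; μ-identityˡ  = μ-identityˡ
        ; μ-identityʳ  = μ-identityʳ
        ; μ-assoc      = μ-assoc
        }

-- As `arr` and `μ` are pinned down by their equations with the epic `acc`, they enter as records:
-- each is shown to exist, and the remaining claims are proved for an arbitrary choice.
theorem1 : ∀ {o ℓ e} (𝐂 : UniformMarkovCategory o ℓ e) →
    let open UniformMarkovCategory 𝐂
        open Multisets 𝐂
    in TensorsOfAccAreCoequalisers →
       Arrangement ×
       ((A : Arrangement) → let open Sums A in
         (∀ K L X →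
            (plus K L {X} ∘ (acc K ⊗₁ acc L) ≈ acc (K + L) ∘ ++ K L) ×
            (∀ (h : M₀ K X ⊗₀ M₀ L X ⇒ M₀ (K + L) X) →
               h ∘ (acc K ⊗₁ acc L) ≈ acc (K + L) ∘ ++ K L → h ≈ plus K L) ×
            Deterministic (plus K L {X})) ×
         (∀ K L {X Y} (f : X ⇒ Y) → sum K L ∘ M₁ L f ^₁ K ≈ M₁ (K * L) f ∘ sum K L) ×
         Multiplication ×
         ((M : Multiplication) → let open Multiplication M in
           (∀ K L {X Y} (f : X ⇒ Y) → μ K L Y ∘ M₁ K (M₁ L f) ≈ M₁ (K * L) f ∘ μ K L X) ×
           IsGradedMonad category M₀ M₁ η μ))
theorem1 𝐂 coeq⊗ = arrangement , λ A →
    (λ K L X →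
       plus-acc A coeq⊗ K L ,
       (λ h eq → IsCoequaliser.unique (coeq⊗ K L X) (≈.trans eq (≈.sym (plus-acc A coeq⊗ K L)))) ,
       plus-det A coeq⊗ K L) ,
    (λ K L → sum-natural A coeq⊗ K L) ,
    multiplication A coeq⊗ ,
    λ M → (λ K L → μ-natural A coeq⊗ M K L) , isGradedMonad A coeq⊗ M
  where
  open UniformMarkovCategory 𝐂
  open Shuffles 𝐂
  open SumsOfMultisets 𝐂
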